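{- Every planar graph $G$ with girth at least $5$ and at least two vertices satisfies $\rho_2(G)\ge 1/22$.
   Context: Firefighter process: in a finite simple graph $G$, a fire starts at time $0$ at a vertex $v$. At each subsequent time step, the firefighters first protect at most $k$ vertices that are not burning (protection is permanent), and then the fire spreads from every burning vertex to all its unprotected neighbours. A vertex is saved if it never burns. Let $sn_k(G,v)$ be the maximum number of vertices of $G$ that can be saved when the fire starts at $v$. For a graph $G$ on $n$ vertices, the $k$-surviving rate is $\rho_k(G)=\frac{1}{n^2}\sum_{v\in V(G)} sn_k(G,v)$. The girth of a graph is the length of a shortest cycle (infinite for forests). -}

module Defs where

open import Data.Bool.Base using (true; false)
open import Data.Fin.Base using (Fin; zero; suc; inject₁; fromℕ)
open import Data.Fin.Properties using (any?; _<?_)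
open import Data.Fin.Subset
  using (Subset; inside; outside; _∈_; _∉_; _⊆_; _∪_; ∁; ⁅_⁆; ∣_∣; Lift)
  renaming (⊥ to ∅)
open import Data.Fin.Subset.Properties
  using (_∈?_; ∉⊥; ∣⊥∣≡0; ∣⁅x⁆∣≡1; ∣p∣≤n; p⊆q⇒∣p∣≤∣q∣; p⊂q⇒∣p∣<∣q∣;
         p⊆p∪q; x∈∁p⇒x∉p; x∉p⇒x∈∁p; Lift?)
open import Data.Integer.Base using (+_)
open import Data.List.Base
  using (List; []; _∷_; length; filter; map; _++_; allFin; cartesianProduct)
open import Data.List.Extrema.Nat using (argmax; argmax-sel; f[xs]≤f[argmax])
open import Data.List.Membership.Propositional using () renaming (_∈_ to _∈ˡ_)
open import Data.List.Membership.Propositional.Properties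
  using (∈-filter⁺; ∈-filter⁻; ∈-map⁺; ∈-++⁺ˡ; ∈-++⁺ʳ)
open import Data.List.Relation.Unary.Any using (here)
import Data.List.Relation.Unary.All as All
open import Data.Nat.Base using (ℕ; zero; suc; _+_; _*_; _≤_; z≤n; s≤s; NonZero)
open import Data.Nat.GeneralisedArithmetic using (iterate)
open import Data.Nat.ListAction using (sum)
open import Data.Nat.Properties
  using (+-comm; ≤-trans; ≤-reflexive; <-irrefl; m*n≢0; _≤?_)
open import Data.Product.Base using (Σ-syntax; ∃; ∃-syntax; _×_; _,_; proj₁; proj₂)
open import Data.Rational.Base using (ℚ; _/_)
open import Data.Sum.Base using (_⊎_; inj₁; inj₂)
open import Data.Vec.Base using ([]; _∷_; tabulate)
open import Data.Vec.Properties using (lookup∘tabulate; lookup⇒[]=; []=⇒lookup)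
open import Function.Base using (_∘_; id)
open import Function.Bundles using (_⇔_; mk⇔; Equivalence)
open import Function.Definitions using (Injective; StrictlySurjective)
open import Level using (0ℓ)
open import Relation.Binary.Core using (Rel)
open import Relation.Binary.Definitions using (Symmetric; Irreflexive; Decidable)
open import Relation.Binary.Construct.Closure.ReflexiveTransitive using (Star)
open import Relation.Binary.PropositionalEquality
  using (_≡_; refl; sym; trans; cong; subst)
open import Relation.Nullary.Decidable
  using (Dec; yes; no; does; ¬?; _×-dec_; _⊎-dec_; dec-true)
open import Relation.Nullary.Negation using (contradiction)

------------------------------------------------------------------------
-- Finite simple graphs

record SimpleGraph (n : ℕ) : Set₁ where
  infix 4 _~_ _~?_
  field
    _~_      : Rel (Fin n) 0ℓ
    _~?_     : Decidable _~_
    ~-sym    : Symmetric _~_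
    ~-irrefl : Irreflexive _≡_ _~_

  edges : List (Fin n × Fin n)
  edges = filter (λ (u , v) → (u <? v) ×-dec (u ~? v))
                 (cartesianProduct (allFin n) (allFin n))

  isolatedVertices : List (Fin n)
  isolatedVertices = filter (λ v → ¬? (any? (v ~?_))) (allFin n)

  Connected : Rel (Fin n) 0ℓ
  Connected = Star _~_

------------------------------------------------------------------------
-- Girth

module _ {n : ℕ} (G : SimpleGraph n) where
  open SimpleGraph G

  data Cycle : ℕ → Set where
    cycle : ∀ {m} (c : Fin (suc m) → Fin n) →
            3 ≤ suc m →
            Injective _≡_ _≡_ c →
            (∀ (i : Fin m) → c (inject₁ i) ~ c (suc i)) →
            c (fromℕ m) ~ c zero →
            Cycle (suc m)

  -- The girth of a forest is infinite, so a forest has girth at least g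
  -- for every g.
  GirthAtLeast : ℕ → Set
  GirthAtLeast g = ∀ {ℓ} → Cycle ℓ → g ≤ ℓ

------------------------------------------------------------------------
-- Planarity, via combinatorial maps: a rotation system describes a
-- cellular embedding of each component of G in a closed oriented
-- surface, and G is planar when some rotation system embeds every
-- component in the sphere.

-- The relation R has exactly k equivalence classes.
record HasClasses {a} {A : Set a} (R : Rel A 0ℓ) (k : ℕ) : Set a where
  field
    class            : A → Fin k
    class-surjective : StrictlySurjective _≡_ class
    class-kernel     : ∀ x y → class x ≡ class y ⇔ R x y

module _ {n : ℕ} (G : SimpleGraph n) where
  open SimpleGraph G

  -- For each vertex v, a cyclic permutation of the neighbours of v; the
  -- values rot v w with w not adjacent to v are irrelevant.
  record RotationSystem : Set where
    field
      rot           : Fin n → Fin n → Fin n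
      rot-adj       : ∀ {v w} → v ~ w → v ~ rot v w
      rot-injective : ∀ {v w w′} → v ~ w → v ~ w′ → rot v w ≡ rot v w′ → w ≡ w′
      rot-cyclic    : ∀ {v w w′} → v ~ w → v ~ w′ → ∃[ k ] iterate (rot v) w k ≡ w′

    Dart : Set
    Dart = Σ[ (u , v) ∈ Fin n × Fin n ] u ~ v

    -- Traverse u → v, then leave v along the edge following vu in the
    -- rotation at v. The orbits on darts are the facial walks.
    nextDart : Fin n × Fin n → Fin n × Fin n
    nextDart (u , v) = v , rot v u

    SameFace : Rel Dart 0ℓ
    SameFace (d , _) (d′ , _) = ∃[ k ] iterate nextDart d k ≡ d′

  -- With C components, I isolated vertices and F facial walks, the Euler
  -- characteristics of the component surfaces add up to n − |E| + (F + I):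
  -- an isolated vertex lies on a sphere with a single face, which has no
  -- darts. Each of the C characteristics is at most 2, so the total is 2C
  -- exactly when every component is embedded in the sphere.
  record Planar : Set where
    field
      rotationSystem : RotationSystem
    open RotationSystem rotationSystem
    field
      #faces        : ℕ
      #components   : ℕ
      faces         : HasClasses SameFace #faces
      components    : HasClasses Connected #components
      euler         : n + (#faces + length isolatedVertices)
                      ≡ length edges + 2 * #components

------------------------------------------------------------------------
-- The firefighter process

subsets : ∀ n → List (Subset n)
subsets zero    = [] ∷ []
subsets (suc n) = map (inside ∷_) (subsets n) ++ map (outside ∷_) (subsets n)

module Firefighter {n : ℕ} (G : SimpleGraph n) where
  open SimpleGraph G

  record State : Set where
    constructor ⟨_,_⟩
    field
      protected burning : Subset n
  open State public

  Burns : Subset n → Subset n → Fin n → Set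
  Burns P B w = w ∈ B ⊎ (w ∉ P × ∃[ u ] (u ∈ B × u ~ w))

  burns? : ∀ P B w → Dec (Burns P B w)
  burns? P B w =
    (w ∈? B) ⊎-dec (¬? (w ∈? P) ×-dec any? (λ u → (u ∈? B) ×-dec (u ~? w)))

  spread : Subset n → Subset n → Subset n
  spread P B = tabulate (does ∘ burns? P B)

  round : Subset n → State → State
  round Q ⟨ P , B ⟩ = ⟨ P ∪ Q , spread (P ∪ Q) B ⟩

  LegalMove : ℕ → State → Subset n → Set
  LegalMove k st Q = ∣ Q ∣ ≤ k × Lift (_∉ burning st) Q

  -- The set protected in each round; the fire is deterministic, so
  -- nothing is gained by letting the choice depend on its progress.
  Strategy : Set
  Strategy = ℕ → Subset n

  run : Strategy → State → ℕ → State
  run s st zero    = st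
  run s st (suc t) = round (s t) (run s st t)

  Legal : ℕ → State → Strategy → Set
  Legal k st s = ∀ t → LegalMove k (run s st t) (s t)

  ignite : Fin n → State
  ignite v = ⟨ ∅ , ⁅ v ⁆ ⟩

  Saved : Strategy → State → Fin n → Set
  Saved s st w = ∀ t → w ∉ burning (run s st t)

  CanSave : ℕ → Fin n → Subset n → Set
  CanSave k v S =
    ∃[ s ] (Legal k (ignite v) s × (∀ w → w ∈ S ⇔ Saved s (ignite v) w))

  IsMaxSaved : ℕ → Fin n → ℕ → Set
  IsMaxSaved k v m =
    (∃[ S ] (CanSave k v S × ∣ S ∣ ≡ m)) × (∀ S → CanSave k v S → ∣ S ∣ ≤ m)

  legalMove? : ∀ k st Q → Dec (LegalMove k st Q)
  legalMove? k st Q = (∣ Q ∣ ≤? k) ×-dec Lift? (λ w → ¬? (w ∈? burning st)) Q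

  mutual
    -- The largest number of vertices not burning after t further rounds.
    best : ℕ → ℕ → State → ℕ
    best k zero    st = ∣ ∁ (burning st) ∣
    best k (suc t) st = best k t (round (bestMove k t st) st)

    bestMove : ℕ → ℕ → State → Subset n
    bestMove k t st =
      argmax (λ Q → best k t (round Q st)) ∅ (filter (legalMove? k st) (subsets n))

  -- The fire stops spreading within n rounds; sn-isMaxSaved below shows
  -- that this is the maximum over all legal strategies of unbounded length.
  sn : ℕ → Fin n → ℕ
  sn k v = best k n (ignite v)

  -- The k-surviving rate.
  ρ : ℕ → .{{_ : NonZero n}} → ℚ
  ρ k = (+ sum (map (sn k) (allFin n)) / (n * n)) {{m*n≢0 n n}}

------------------------------------------------------------------------
-- sn k v is the maximum number of vertices that can be saved

∈-subsets : ∀ {n} (p : Subset n) → p ∈ˡ subsets n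
∈-subsets []           = here refl
∈-subsets (true  ∷ p) = ∈-++⁺ˡ (∈-map⁺ (inside ∷_) (∈-subsets p))
∈-subsets (false ∷ p) =
  ∈-++⁺ʳ (map (inside ∷_) (subsets _)) (∈-map⁺ (outside ∷_) (∈-subsets p))

module FirefighterProperties {n : ℕ} (G : SimpleGraph n) where
  open SimpleGraph G
  open Firefighter G

  ∈-spread⁺ : ∀ P B {w} → Burns P B w → w ∈ spread P B
  ∈-spread⁺ P B {w} b =
    lookup⇒[]= w _ (trans (lookup∘tabulate (does ∘ burns? P B) w) (dec-true (burns? P B w) b))

  ∈-spread⁻ : ∀ P B {w} → w ∈ spread P B → Burns P B w
  ∈-spread⁻ P B {w} w∈ =
    does⇒ (burns? P B w) (trans (sym (lookup∘tabulate (does ∘ burns? P B) w)) ([]=⇒lookup w∈))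
    where
    does⇒ : ∀ {A : Set} (a? : Dec A) → does a? ≡ true → A
    does⇒ (yes a) _ = a

  run-suc : ∀ s st t → run s st (suc t) ≡ run (s ∘ suc) (round (s 0) st) t
  run-suc s st zero    = refl
  run-suc s st (suc t) = cong (round (s (suc t))) (run-suc s st t)

  ∅-legal : ∀ k st → LegalMove k st ∅
  ∅-legal k st = ≤-trans (≤-reflexive (∣⊥∣≡0 n)) z≤n , λ x∈∅ → contradiction x∈∅ ∉⊥

  bestMove-legal : ∀ k t st → LegalMove k st (bestMove k t st)
  bestMove-legal k t st
    with argmax-sel (λ Q → best k t (round Q st)) ∅ (filter (legalMove? k st) (subsets n))
  ... | inj₁ eq = subst (LegalMove k st) (sym eq) (∅-legal k st)
  ... | inj₂ m∈ = proj₂ (∈-filter⁻ (legalMove? k st) {xs = subsets n} m∈)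

  bestMove-max : ∀ k t st {Q} → LegalMove k st Q →
                 best k t (round Q st) ≤ best k (suc t) st
  bestMove-max k t st {Q} legal =
    All.lookup (f[xs]≤f[argmax] {f = λ R → best k t (round R st)} ∅
                                  (filter (legalMove? k st) (subsets n)))
               (∈-filter⁺ (legalMove? k st) (∈-subsets Q) legal)

  best-upper : ∀ k t st s → Legal k st s →
               ∣ ∁ (burning (run s st t)) ∣ ≤ best k t st
  best-upper k zero    st s legal = ≤-reflexive refl
  best-upper k (suc t) st s legal =
    ≤-trans (≤-reflexive (cong (∣_∣ ∘ ∁ ∘ burning) (run-suc s st t))) (≤-trans
            (best-upper k t (round (s 0) st) (s ∘ suc)
              (λ u → subst (λ x → LegalMove k x (s (suc u))) (run-suc s st u) (legal (suc u))))
            (bestMove-max k t st (legal 0)))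

  bestStrategy : ℕ → ℕ → State → Strategy
  bestStrategy k zero    st _       = ∅
  bestStrategy k (suc t) st zero    = bestMove k t st
  bestStrategy k (suc t) st (suc u) = bestStrategy k t (round (bestMove k t st) st) u

  bestStrategy-legal : ∀ k t st → Legal k st (bestStrategy k t st)
  bestStrategy-legal k zero    st u       = ∅-legal k (run (λ _ → ∅) st u)
  bestStrategy-legal k (suc t) st zero    = bestMove-legal k t st
  bestStrategy-legal k (suc t) st (suc u) =
    subst (λ x → LegalMove k x (bestStrategy k (suc t) st (suc u)))
          (sym (run-suc (bestStrategy k (suc t) st) st u))
          (bestStrategy-legal k t (round (bestMove k t st) st) u)

  bestStrategy-best : ∀ k t st →
    ∣ ∁ (burning (run (bestStrategy k t st) st t)) ∣ ≡ best k t st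
  bestStrategy-best k zero    st = refl
  bestStrategy-best k (suc t) st =
    trans (cong (∣_∣ ∘ ∁ ∘ burning) (run-suc (bestStrategy k (suc t) st) st t))
          (bestStrategy-best k t (round (bestMove k t st) st))

  Stable : State → Set
  Stable st = spread (protected st) (burning st) ⊆ burning st

  burning-grows : ∀ Q st → burning st ⊆ burning (round Q st)
  burning-grows Q ⟨ P , B ⟩ w∈B = ∈-spread⁺ (P ∪ Q) B (inj₁ w∈B)

  stable-burning : ∀ Q st → Stable st → burning (round Q st) ⊆ burning st
  stable-burning Q ⟨ P , B ⟩ stable w∈ with ∈-spread⁻ (P ∪ Q) B w∈
  ... | inj₁ w∈B         = w∈B
  ... | inj₂ (w∉P∪Q , e) = stable (∈-spread⁺ P B (inj₂ (w∉P∪Q ∘ p⊆p∪q Q , e)))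

  no-growth⇒stable : ∀ Q st → burning (round Q st) ⊆ burning st → Stable (round Q st)
  no-growth⇒stable Q ⟨ P , B ⟩ sub w∈ with ∈-spread⁻ (P ∪ Q) (spread (P ∪ Q) B) w∈
  ... | inj₁ w∈B                 = w∈B
  ... | inj₂ (w∉ , u , u∈ , u~w) = ∈-spread⁺ (P ∪ Q) B (inj₂ (w∉ , u , sub u∈ , u~w))

  stable⇒stable : ∀ Q st → Stable st → Stable (round Q st)
  stable⇒stable Q st stable = no-growth⇒stable Q st (stable-burning Q st stable)

  stable-or-large : ∀ s v t → Stable (run s (ignite v) t) ⊎
                              suc t ≤ ∣ burning (run s (ignite v) t) ∣
  stable-or-large s v zero = inj₂ (≤-reflexive (sym (∣⁅x⁆∣≡1 v)))
  stable-or-large s v (suc t) with run s (ignite v) t | stable-or-large s v t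
  ... | st | inj₁ stable = inj₁ (stable⇒stable (s t) st stable)
  ... | st | inj₂ large
    with any? (λ w → (w ∈? burning (round (s t) st)) ×-dec ¬? (w ∈? burning st))
  ...   | yes new = inj₂ (≤-trans (s≤s large) (p⊂q⇒∣p∣<∣q∣ (burning-grows (s t) st , new)))
  ...   | no ¬new = inj₁ (no-growth⇒stable (s t) st sub)
    where
    sub : burning (round (s t) st) ⊆ burning st
    sub {w} w∈ with w ∈? burning st
    ... | yes w∈B = w∈B
    ... | no  w∉B = contradiction (w , w∈ , w∉B) ¬new

  stable-at-n : ∀ s v → Stable (run s (ignite v) n)
  stable-at-n s v with stable-or-large s v n
  ... | inj₁ stable = stable
  ... | inj₂ large  = contradiction (≤-trans large (∣p∣≤n (burning (run s (ignite v) n)))) (<-irrefl refl)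

  stable-run : ∀ s st → Stable st → ∀ t → burning (run s st t) ⊆ burning st × Stable (run s st t)
  stable-run s st stable zero    = id , stable
  stable-run s st stable (suc t) with run s st t | stable-run s st stable t
  ... | st′ | sub , stable′ =
    sub ∘ stable-burning (s t) st′ stable′ , stable⇒stable (s t) st′ stable′

  burning-mono : ∀ s st t u → burning (run s st t) ⊆ burning (run s st (u + t))
  burning-mono s st t zero    = id
  burning-mono s st t (suc u) = burning-grows (s (u + t)) _ ∘ burning-mono s st t u

  run-+ : ∀ s st t u → run s st (u + t) ≡ run (λ i → s (i + t)) (run s st t) u
  run-+ s st t zero    = refl
  run-+ s st t (suc u) = cong (round (s (u + t))) (run-+ s st t u)

  burning-final : ∀ s v t → burning (run s (ignite v) t) ⊆ burning (run s (ignite v) n)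
  burning-final s v t {w} w∈ =
    proj₁ (stable-run (λ i → s (i + n)) (run s (ignite v) n) (stable-at-n s v) t)
      (subst (λ x → w ∈ burning x) (run-+ s (ignite v) n t)
        (subst (λ x → w ∈ burning (run s (ignite v) x)) (+-comm n t)
          (burning-mono s (ignite v) t n w∈)))

  saved-final : ∀ s v w → w ∈ ∁ (burning (run s (ignite v) n)) ⇔ Saved s (ignite v) w
  saved-final s v w = mk⇔ (λ w∈ t → x∈∁p⇒x∉p w∈ ∘ burning-final s v t)
                          (λ saved → x∉p⇒x∈∁p (saved n))

  sn-isMaxSaved : ∀ k v → IsMaxSaved k v (sn k v)
  sn-isMaxSaved k v =
    (_ , (bestStrategy k n st , bestStrategy-legal k n st , saved-final _ v)
       , bestStrategy-best k n st) ,
    λ S (s , legal , S⇔saved) →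
      ≤-trans (p⊆q⇒∣p∣≤∣q∣ λ {w} w∈S →
                 Equivalence.from (saved-final s v w) (Equivalence.to (S⇔saved w) w∈S))
              (best-upper k n st s legal)
    where st = ignite v

{-# OPTIONS --safe #-}
module Submission where

-- Let T be a breadth-first tree from the fire v, and let two corners of one face
-- of the embedding be joined by a chord inside that face. The chord and the tree
-- paths from v to its two ends form a closed curve. Two firefighters can protect
-- both paths in time, one vertex per path and round, since the fire reaches depth
-- t only in round t; this saves a whole side of the curve, provided that the side
-- contains at most one of the three corners at v when v has degree 3. Among the
-- sides containing at least two of them take a smallest one. A third corner of its
-- face splits it in two, which yields three curves whose savable sides cover
-- everything but v, so a vertex of degree 3 saves a third of the other vertices.
-- A vertex of degree at most 2 saves all of them. Since girth 5 gives 3 |E| ≤ 5 n,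
-- the vertices of degree at most 3 save n² / 12 in total.
--
-- That the curves separate is read off Euler's formula: it forces the edges
-- outside T to be bridges of the dual graph formed by them.

open import Defs
open import Data.Bool.Base using (Bool; true; false; not; _∧_; _∨_; if_then_else_)
open import Data.Bool.Properties using (∧-zeroʳ; ∧-identityʳ; ∨-identityʳ; ∨-zeroʳ)
open import Data.Empty using (⊥)
open import Data.Fin.Base
  using (Fin; zero; suc; toℕ; join; splitAt; combine; punchIn; punchOut; remQuot; fromℕ<)
open import Data.Fin.Properties as Fin
  using (_≟_; injective⇒≤; punchOut-cong; punchOut-punchIn; punchInᵢ≢i; splitAt-join; any?;
         _<?_; <-cmp; remQuot-combine; toℕ<n; toℕ-injective; combine-injective;
         combine-remQuot)
open import Data.Fin.Subset using (Subset; ∣_∣; _∈_; _∉_; _∪_; ∁; ⁅_⁆; ⊤) renaming (⊥ to ∅)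
open import Data.Fin.Subset.Properties
  using (p⊂q⇒∣p∣<∣q∣; ∉⊥; x∈⁅x⁆; x∈⁅y⁆⇒x≡y; x∈p∪q⁻; x∈p∪q⁺; ∣⁅x⁆∣≡1; ∣⊤∣≡n; p⊆q⇒∣p∣≤∣q∣;
         x∉p⇒x∈∁p; ∣⊥∣≡0)
open import Data.Integer.Base as ℤ using (+_; +≤+)
import Data.Integer.Properties as ℤ
open import Data.List.Base
  using (List; []; _∷_; length; filter; map; lookup; cartesianProduct; allFin; foldr)
open import Data.List.Membership.Propositional using (lose) renaming (_∈_ to _∈ˡ_)
open import Data.List.Membership.Propositional.Properties
  using (∈-lookup; ∈-filter⁺; ∈-filter⁻; ∈-map⁺; ∈-allFin; ∈-cartesianProduct⁺)
open import Data.List.Properties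
  using (filter-++; length-++; length-map; filter-notAll; length-tabulate)
open import Data.List.Relation.Unary.All as All using (All; []; _∷_)
open import Data.List.Relation.Unary.AllPairs using ([]; _∷_)
open import Data.List.Relation.Unary.Any using (here; there; index)
open import Data.List.Relation.Unary.Any.Properties using (lookup-index)
open import Data.List.Relation.Unary.Unique.Propositional using (Unique)
open import Data.List.Relation.Unary.Unique.Propositional.Properties
  using (filter⁺; allFin⁺; cartesianProduct⁺)
open import Data.Nat.Base
  using (ℕ; zero; suc; _+_; _*_; _<_; z≤n; s≤s; pred; _⊔_; s≤s⁻¹; _∸_; NonZero)
  renaming (_≤_ to _≤ⁿ_)
open import Data.Nat.GeneralisedArithmetic using (iterate)
open import Data.Nat.ListAction using (sum)
import Data.Nat.Properties as ℕ
open import Data.Nat.Tactic.RingSolver using (solve-∀)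
open import Data.Product.Base
  using (Σ-syntax; ∃; ∃-syntax; _×_; _,_; proj₁; proj₂; swap; uncurry)
open import Data.Product.Properties using (≡-dec)
open import Data.Rational.Base using (_/_; _≤_)
import Data.Rational.Properties as ℚ
import Data.Rational.Unnormalised.Base as ℚᵘ
import Data.Rational.Unnormalised.Properties as ℚᵘ
open import Data.Sum.Base using (_⊎_; inj₁; inj₂)
open import Data.Sum.Properties using (inj₁-injective; inj₂-injective)
open import Data.Vec.Base using (tabulate; []; _∷_)
open import Data.Vec.Properties using (lookup∘tabulate; lookup⇒[]=; []=⇒lookup)
open import Function.Base using (_∘_; id; case_of_)
open import Function.Bundles using (Equivalence)
open import Function.Definitions using (Injective; StrictlySurjective)
open import Level using (0ℓ)
open import Relation.Binary.Construct.Closure.ReflexiveTransitive using (ε; _◅_; _◅◅_)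
open import Relation.Binary.Definitions using (tri<; tri≈; tri>)
open import Relation.Binary.PropositionalEquality
  using (_≡_; _≢_; refl; sym; trans; cong; cong₂; subst; subst₂)
open import Relation.Nullary.Decidable
  using (Dec; yes; no; ¬?; _⊎-dec_; _×-dec_; does; dec-true; dec-false)
open import Relation.Nullary.Negation using (contradiction; ¬_)
open import Relation.Unary using (Pred; Decidable)

-- The Jordan curve theorem is replaced by Boolean labellings of darts: a side of a curve is a
-- labelling that is constant across nontree edges and along facial walks, except at the two ends of
-- the chord. The tree paths are not part of this definition. That the label changes only along them
-- comes from an induction from the leaves: a subtree disjoint from the paths offers no place for a
-- change. The fire starts on the curve, which is why the corners at `v` matter. A chord end at `v`
-- frees a firefighter for a single inside neighbour; if no chord ends there, a lone inside
-- neighbour already lies on a path. With three corners no tie is possible, so exactly one of a side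
-- and its complement has a majority, and the complement of the side that is finally split serves as
-- the third curve. The tree is breadth-first for two reasons. Depths then bound the arrival of the
-- fire from below, and all edges at `v` are tree edges, so moving a chord across a nontree edge
-- leaves the count at `v` unchanged.

private
  variable
    A B : Set

-- Iteration, lists without repetition, and quotients of finite sets

iterate-suc : (f : A → A) (x : A) (k : ℕ) → iterate f x (suc k) ≡ f (iterate f x k)
iterate-suc f x zero    = refl
iterate-suc f x (suc k) = iterate-suc f (f x) k

iterate-+ : (f : A → A) (x : A) (j k : ℕ) →
            iterate f x (j + k) ≡ iterate f (iterate f x j) k
iterate-+ f x zero    k = refl
iterate-+ f x (suc j) k = iterate-+ f (f x) j k

join-injective : ∀ {m n} → Injective _≡_ _≡_ (join m n)
join-injective {m} {n} {x} {y} eq =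
  trans (sym (splitAt-join m n x)) (trans (cong (splitAt m) eq) (splitAt-join m n y))

index-injective : {xs : List A} {x y : A} (p : x ∈ˡ xs) (q : y ∈ˡ xs) →
                  index p ≡ index q → x ≡ y
index-injective {xs = xs} p q eq =
  trans (lookup-index p) (trans (cong (lookup xs) eq) (sym (lookup-index q)))

lookup-injective : {xs : List A} → Unique xs → Injective _≡_ _≡_ (lookup xs)
lookup-injective {xs = x ∷ xs} (x∉ ∷ u) {zero}  {zero}  eq = refl
lookup-injective {xs = x ∷ xs} (x∉ ∷ u) {zero}  {suc j} eq =
  contradiction eq (All.lookup x∉ (∈-lookup {xs = xs} j))
lookup-injective {xs = x ∷ xs} (x∉ ∷ u) {suc i} {zero}  eq =
  contradiction (sym eq) (All.lookup x∉ (∈-lookup {xs = xs} i))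
lookup-injective {xs = x ∷ xs} (x∉ ∷ u) {suc i} {suc j} eq =
  cong suc (lookup-injective u eq)

length-filter-¬ : {P : Pred A 0ℓ} (P? : Decidable P) (xs : List A) →
                  length xs ≡ length (filter P? xs) + length (filter (¬? ∘ P?) xs)
length-filter-¬ P? [] = refl
length-filter-¬ P? (x ∷ xs) with P? x
... | yes _ = cong suc (length-filter-¬ P? xs)
... | no  _ = trans (cong suc (length-filter-¬ P? xs)) (sym (ℕ.+-suc _ _))

length-filter-map : {P : Pred B 0ℓ} (P? : Decidable P) (f : A → B) (xs : List A) →
                    length (filter P? (map f xs)) ≡ length (filter (P? ∘ f) xs)
length-filter-map P? f [] = refl
length-filter-map P? f (x ∷ xs) with P? (f x)
... | yes _ = cong suc (length-filter-map P? f xs)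
... | no  _ = length-filter-map P? f xs

length-filter-cartesianProduct :
  {P : Pred (A × B) 0ℓ} (P? : Decidable P) (xs : List A) (ys : List B) →
  length (filter P? (cartesianProduct xs ys)) ≡
  sum (map (λ x → length (filter (λ y → P? (x , y)) ys)) xs)
length-filter-cartesianProduct P? [] ys = refl
length-filter-cartesianProduct P? (x ∷ xs) ys =
  trans (cong length (filter-++ P? (map (x ,_) ys) (cartesianProduct xs ys)))
        (trans (length-++ (filter P? (map (x ,_) ys)))
               (cong₂ _+_ (length-filter-map P? (x ,_) ys)
                          (length-filter-cartesianProduct P? xs ys)))

sum-map-≤ : (f g : A → ℕ) (xs : List A) → (∀ x → f x ≤ⁿ g x) → sum (map f xs) ≤ⁿ sum (map g xs)
sum-map-≤ f g []       f≤g = z≤n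
sum-map-≤ f g (x ∷ xs) f≤g = ℕ.+-mono-≤ (f≤g x) (sum-map-≤ f g xs f≤g)

-- As in union-find: every identification merges at most two classes.
quotient : ∀ {m} (L : List (Fin m × Fin m)) →
           ∃[ k ] Σ[ g ∈ (Fin m → Fin k) ]
             StrictlySurjective _≡_ g × All (λ (x , y) → g x ≡ g y) L × m ≤ⁿ k + length L
quotient {m} [] = m , id , (λ y → y , refl) , [] , ℕ.m≤m+n m 0
quotient ((x , y) ∷ L) with quotient L
... | k , g , surj , resp , bound with g x ≟ g y
...   | yes eq = k , g , surj , eq ∷ resp ,
                 ℕ.≤-trans bound (ℕ.+-monoʳ-≤ k (ℕ.n≤1+n _))
...   | no ≢ with k
...     | zero  = contradiction (g x) λ ()
...     | suc k = k , h ∘ g , h∘g-surjective , hx≡hy ∷ All.map (cong h) resp ,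
                  ℕ.≤-trans bound (ℕ.≤-reflexive (sym (ℕ.+-suc k (length L))))
  where
  h : Fin (suc k) → Fin k
  h z with g x ≟ z
  ... | yes _  = punchOut ≢
  ... | no  x≢ = punchOut x≢
  hx≡hy : h (g x) ≡ h (g y)
  hx≡hy with g x ≟ g x | g x ≟ g y
  ... | yes _ | yes _ = refl
  ... | yes _ | no x≢ = punchOut-cong (g x) refl
  ... | no x≢ | _     = contradiction refl x≢
  h-punchIn : ∀ c → h (punchIn (g x) c) ≡ c
  h-punchIn c with g x ≟ punchIn (g x) c
  ... | yes eq = contradiction (sym eq) (punchInᵢ≢i (g x) c)
  ... | no x≢  = trans (punchOut-cong (g x) refl) (punchOut-punchIn (g x))
  h∘g-surjective : StrictlySurjective _≡_ (h ∘ g)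
  h∘g-surjective c with surj (punchIn (g x) c)
  ... | z , eq = z , trans (cong h eq) (h-punchIn c)

-- Rotation systems

bounded : ∀ {n} (f : Fin n → ℕ) → ∃[ b ] (∀ i → f i ≤ⁿ b)
bounded {zero}  f = 0 , λ ()
bounded {suc n} f with bounded (λ i → f (suc i))
... | b , f≤b = f zero ⊔ b , λ where
  zero    → ℕ.m≤m⊔n (f zero) b
  (suc i) → ℕ.≤-trans (f≤b i) (ℕ.m≤n⊔m (f zero) b)

module Darts {n : ℕ} (G : SimpleGraph n) (R : RotationSystem G) where
  open SimpleGraph G
  open RotationSystem R

  IsDart : Fin n × Fin n → Set
  IsDart (u , w) = u ~ w

  infix 4 _≟ᵈ_
  _≟ᵈ_ : (d e : Fin n × Fin n) → Dec (d ≡ e)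
  _≟ᵈ_ = ≡-dec _≟_ _≟_

  ~⇒≢ : ∀ {u w} → u ~ w → u ≢ w
  ~⇒≢ u~w u≡w = ~-irrefl u≡w u~w

  nextDart-dart : ∀ {d} → IsDart d → IsDart (nextDart d)
  nextDart-dart u~w = rot-adj (~-sym u~w)

  iterate-dart : ∀ {d} k → IsDart d → IsDart (iterate nextDart d k)
  iterate-dart zero    d = d
  iterate-dart (suc k) d = iterate-dart k (nextDart-dart d)

  nextDart-injective : ∀ {d e} → IsDart d → IsDart e → nextDart d ≡ nextDart e → d ≡ e
  nextDart-injective {u , w} {u′ , w′} d e eq with refl ← cong proj₁ eq =
    cong (_, w) (rot-injective (~-sym d) (~-sym e) (cong proj₂ eq))

  iterate-injective : ∀ {d e} k → IsDart d → IsDart e →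
                      iterate nextDart d k ≡ iterate nextDart e k → d ≡ e
  iterate-injective zero    d e eq = eq
  iterate-injective (suc k) d e eq =
    nextDart-injective d e (iterate-injective k (nextDart-dart d) (nextDart-dart e) eq)

  nextDart≢ : ∀ {d} → IsDart d → nextDart d ≢ d
  nextDart≢ d eq = ~⇒≢ d (sym (cong proj₁ eq))

  rot-iterate-adj : ∀ {w u} k → w ~ u → w ~ iterate (rot w) u k
  rot-iterate-adj zero    w~u = w~u
  rot-iterate-adj (suc k) w~u = rot-iterate-adj k (rot-adj w~u)

  prevDart : ∀ {d} → IsDart d → ∃[ e ] (IsDart e × nextDart e ≡ d)
  prevDart {w , u} w~u with rot-cyclic (rot-adj w~u) w~u
  ... | k , eq = (iterate (rot w) u k , w) , ~-sym (rot-iterate-adj k w~u) ,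
                 cong (w ,_) (trans (sym (iterate-suc (rot w) u k)) eq)

  module _ {A : Set} (σ : Fin n × Fin n → A) where

    -- Going once around w, starting just after p, only the step out of p is skipped.
    vertex-constant : ∀ {w p} → w ~ p →
      (∀ {u} → w ~ u → u ≢ p → σ (w , u) ≡ σ (w , rot w u)) →
      ∀ {u} → w ~ u → σ (w , u) ≡ σ (w , rot w p)
    vertex-constant {w} {p} w~p step w~u with rot-cyclic (rot-adj w~p) w~u
    ... | k , refl = go k (rot-adj w~p) refl
      where
      go : ∀ {x} k → w ~ x → σ (w , x) ≡ σ (w , rot w p) →
           σ (w , iterate (rot w) x k) ≡ σ (w , rot w p)
      go zero    w~x eq = eq
      go {x} (suc k) w~x eq with x ≟ p
      ... | yes refl = go k (rot-adj w~x) refl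
      ... | no x≢p   = go k (rot-adj w~x) (trans (sym (step w~x x≢p)) eq)

    -- Reversing a dart out of `u` and taking the facial step is the rotation at `u`, so the label
    -- is constant around each vertex; reversal alone carries it to the neighbours.
    component-constant :
      (∀ {d} → IsDart d → σ d ≡ σ (nextDart d)) → (∀ {d} → IsDart d → σ d ≡ σ (swap d)) →
      ∀ {u u′ w w′} → Connected u u′ → u ~ w → u′ ~ w′ → σ (u , w) ≡ σ (u′ , w′)
    component-constant next flip = go
      where
      turn : ∀ {u w w′} → u ~ w → u ~ w′ → σ (u , w) ≡ σ (u , w′)
      turn {u} {w} u~w u~w′ = trans (around u~w) (sym (around u~w′))
        where
        around : ∀ {x} → u ~ x → σ (u , x) ≡ σ (u , rot u w)
        around = vertex-constant u~w (λ u~x _ → trans (flip u~x) (next (~-sym u~x)))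
      go : ∀ {u u′ w w′} → Connected u u′ → u ~ w → u′ ~ w′ → σ (u , w) ≡ σ (u′ , w′)
      go ε             u~w u′~w′ = turn u~w u′~w′
      go (u~x ◅ x~*u′) u~w u′~w′ =
        trans (turn u~w u~x) (trans (flip u~x) (go x~*u′ (~-sym u~x) u′~w′))

  -- `depth-adj` is the breadth-first property, which ties depth to the time at which the fire can
  -- arrive. A root is its own parent, so `parent` is total, and `pred` lets `depth-parent` cover
  -- roots.
  record Forest : Set where
    field
      root parent  : Fin n → Fin n
      depth        : Fin n → ℕ
      root-adj     : ∀ {u w} → u ~ w → root u ≡ root w
      depth-adj    : ∀ {u w} → u ~ w → depth w ≤ⁿ suc (depth u)
      root-depth-0 : ∀ {w} → depth w ≡ 0 → root w ≡ w
      parent-adj   : ∀ {w} → depth w ≢ 0 → w ~ parent w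
      parent-root  : ∀ {w} → depth w ≡ 0 → parent w ≡ w
      depth-parent : ∀ w → depth (parent w) ≡ pred (depth w)

    Tree : Fin n × Fin n → Set
    Tree (u , w) = parent u ≡ w ⊎ parent w ≡ u

    tree? : ∀ d → Dec (Tree d)
    tree? (u , w) = (parent u ≟ w) ⊎-dec (parent w ≟ u)

    Tree-swap : ∀ {d} → Tree d → Tree (swap d)
    Tree-swap (inj₁ p) = inj₂ p
    Tree-swap (inj₂ p) = inj₁ p

    depth-child : ∀ {c w} → c ~ w → parent c ≡ w → depth c ≡ suc (depth w)
    depth-child {c} c~w refl with depth c in eq | depth-parent c
    ... | zero  | _  = contradiction (sym (parent-root eq)) (~⇒≢ c~w)
    ... | suc k | dp = cong suc (sym dp)

    -- `P` stands for a union of tree paths to roots. A vertex outside `P` has all its descendants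
    -- outside `P`, so no label can change in its subtree, nor across the edge to its parent.
    -- Changes are thus confined to corners at `P` and to tree edges with both ends in `P`, which is
    -- how two tree paths and a chord come to separate.
    module Subtree {A : Set} (σ : Fin n × Fin n → A) (P : Fin n → Set)
      (P-parent : ∀ {c} → P c → P (parent c))
      (next : ∀ {u w} → u ~ w → ¬ P w → σ (u , w) ≡ σ (w , rot w u))
      (flip : ∀ {d} → IsDart d → ¬ Tree d → σ d ≡ σ (swap d)) where

      Uniform : Fin n → Set
      Uniform w = (∀ {u u′} → w ~ u → w ~ u′ → σ (w , u) ≡ σ (w , u′)) ×
                  (w ~ parent w → σ (w , parent w) ≡ σ (parent w , w))

      -- By induction from the leaves: the edges from w to its children do not
      -- change σ, so going around w the edge to its parent cannot either.
      private
        uniform′ : ∀ h w → proj₁ (bounded depth) ≤ⁿ depth w + h → ¬ P w → Uniform w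
        uniform′ h w bound w∉P = go (w ~? parent w)
          where
          child : ∀ h → proj₁ (bounded depth) ≤ⁿ depth w + h → ∀ {u} → w ~ u → parent u ≡ w →
                  σ (u , w) ≡ σ (w , u)
          child zero bound {u} w~u refl =
            contradiction (ℕ.≤-trans (ℕ.≤-reflexive (sym (depth-child (~-sym w~u) refl)))
                            (ℕ.≤-trans (proj₂ (bounded depth) u)
                              (ℕ.≤-trans bound (ℕ.≤-reflexive (ℕ.+-identityʳ _)))))
                          (ℕ.<-irrefl refl)
          child (suc h) bound {u} w~u refl =
            proj₂ (uniform′ h u
              (ℕ.≤-trans bound (ℕ.≤-reflexive (trans (ℕ.+-suc (depth w) h)
                (cong (_+ h) (sym (depth-child (~-sym w~u) refl))))))
              (λ u∈P → w∉P (P-parent u∈P))) (~-sym w~u)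
          step : ∀ {u} → w ~ u → u ≢ parent w → σ (w , u) ≡ σ (w , rot w u)
          step {u} w~u u≢p with tree? (w , u)
          ... | no ¬t           = trans (flip w~u ¬t) (next (~-sym w~u) w∉P)
          ... | yes (inj₁ refl) = contradiction refl u≢p
          ... | yes (inj₂ p)    = trans (sym (child h bound w~u p)) (next (~-sym w~u) w∉P)
          go : Dec (w ~ parent w) → Uniform w
          go (yes w~p) = (λ w~u w~u′ → trans (around w~u) (sym (around w~u′))) ,
                         (λ _ → trans (around w~p) (sym (next (~-sym w~p) w∉P)))
            where
            around : ∀ {u} → w ~ u → σ (w , u) ≡ σ (w , rot w (parent w))
            around = vertex-constant σ w~p step
          -- Here `w` is a root: there is no parent edge to skip, so the turn around `w` may start
          -- at any neighbour.
          go (no w≁p) = (λ w~u w~u′ → trans (around w~u w~u) (sym (around w~u w~u′))) ,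
                        (λ w~p → contradiction w~p w≁p)
            where
            around : ∀ {p u} → w ~ p → w ~ u → σ (w , u) ≡ σ (w , rot w p)
            around w~p = vertex-constant σ w~p (λ w~u _ → step w~u λ { refl → w≁p w~u })

      uniform : ∀ {w} → ¬ P w → Uniform w
      uniform {w} = uniform′ (proj₁ (bounded depth)) w (ℕ.m≤n+m _ (depth w))

      flip-outside : ∀ {u w} → u ~ w → ¬ P u → ¬ P w → σ (u , w) ≡ σ (w , u)
      flip-outside {u} {w} u~w u∉P w∉P with tree? (u , w)
      ... | no ¬t           = flip u~w ¬t
      ... | yes (inj₁ refl) = proj₂ (uniform u∉P) u~w
      ... | yes (inj₂ refl) = sym (proj₂ (uniform w∉P) (~-sym u~w))

    -- With `P` empty, tree edges cannot change the label either. In dual terms: the nontree edges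
    -- alone already connect all faces of a component.
    nontree-component-constant : ∀ {A : Set} (σ : Fin n × Fin n → A) →
      (∀ {d} → IsDart d → σ d ≡ σ (nextDart d)) →
      (∀ {d} → IsDart d → ¬ Tree d → σ d ≡ σ (swap d)) →
      ∀ {u u′ w w′} → Connected u u′ → u ~ w → u′ ~ w′ → σ (u , w) ≡ σ (u′ , w′)
    nontree-component-constant σ next flip =
      component-constant σ next (λ d → flip-outside d (λ ()) (λ ()))
      where open Subtree σ (λ _ → ⊥) (λ ()) (λ d _ → next d) flip

-- Breadth-first forests

least : {P : ℕ → Set} → Decidable P → ∀ k → P k → ∃[ m ] (P m × (∀ j → P j → m ≤ⁿ j))
least P? zero p = zero , p , λ _ _ → z≤n
least {P} P? (suc k) p with P? zero
... | yes p₀ = zero , p₀ , λ _ _ → z≤n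
... | no ¬p₀ with least (λ j → P? (suc j)) k p
...   | m , pm , min = suc m , pm , below
  where
  below : ∀ j → P j → suc m ≤ⁿ j
  below zero    p₀ = contradiction p₀ ¬p₀
  below (suc j) pj = s≤s (min j pj)

module _ {n C : ℕ} (G : SimpleGraph n) (R : RotationSystem G)
         (components : HasClasses (SimpleGraph.Connected G) C) (v : Fin n) where
  open SimpleGraph G
  open Darts G R
  open HasClasses components

  private
    -- The component of the fire must be rooted at `v`; elsewhere any root will do.
    rep : Fin C → Fin n
    rep c with class v ≟ c
    ... | yes _ = v
    ... | no  _ = proj₁ (class-surjective c)

    class-rep : ∀ c → class (rep c) ≡ c
    class-rep c with class v ≟ c
    ... | yes eq = eq
    ... | no  _  = proj₂ (class-surjective c)

    rep-v : rep (class v) ≡ v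
    rep-v with class v ≟ class v
    ... | yes _ = refl
    ... | no ≢  = contradiction refl ≢

    rt : Fin n → Fin n
    rt w = rep (class w)

    rt-adj : ∀ {u w} → u ~ w → rt u ≡ rt w
    rt-adj u~w = cong rep (Equivalence.from (class-kernel _ _) (u~w ◅ ε))

    Walk : ℕ → Fin n → Set
    Walk zero    w = rt w ≡ w
    Walk (suc k) w = ∃[ u ] (u ~ w × Walk k u)

    walk? : ∀ k → Decidable (Walk k)
    walk? zero    w = rt w ≟ w
    walk? (suc k) w = any? (λ u → (u ~? w) ×-dec walk? k u)

    extend : ∀ {x w} k → Walk k x → Connected x w → ∃[ k′ ] Walk k′ w
    extend k p ε         = k , p
    extend k p (x~y ◅ c) = extend (suc k) (_ , x~y , p) c

    shortest : ∀ w → ∃[ m ] (Walk m w × (∀ j → Walk j w → m ≤ⁿ j))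
    shortest w with extend {rt w} zero (cong rep (class-rep (class w)))
                           (Equivalence.to (class-kernel _ _) (class-rep (class w)))
    ... | k , p = least (λ j → walk? j w) k p

    dp : Fin n → ℕ
    dp w = proj₁ (shortest w)

    dp-min : ∀ {w} j → Walk j w → dp w ≤ⁿ j
    dp-min {w} = proj₂ (proj₂ (shortest w))

    par : ∀ k w → Walk k w → Fin n
    par zero    w _       = w
    par (suc k) w (u , _) = u

    dp-adj : ∀ {u w} → u ~ w → dp w ≤ⁿ suc (dp u)
    dp-adj {u} u~w = dp-min (suc (dp u)) (u , u~w , proj₁ (proj₂ (shortest u)))

    par-adj : ∀ k w (p : Walk k w) → k ≢ 0 → w ~ par k w p
    par-adj zero    w p             k≢0 = contradiction refl k≢0
    par-adj (suc k) w (u , u~w , _) k≢0 = ~-sym u~w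

    par-root : ∀ k w (p : Walk k w) → k ≡ 0 → par k w p ≡ w
    par-root zero w p refl = refl

    par-depth : ∀ k w (p : Walk k w) → k ≡ dp w → dp (par k w p) ≡ pred k
    par-depth zero    w p             eq = sym eq
    par-depth (suc k) w (u , u~w , p) eq =
      ℕ.≤-antisym (dp-min k p) (s≤s⁻¹ (subst (_≤ⁿ suc (dp u)) (sym eq) (dp-adj u~w)))

    rt-0 : ∀ k w → Walk k w → k ≡ 0 → rt w ≡ w
    rt-0 zero w p refl = p

  breadthFirst : Σ[ F ∈ Forest ] Forest.depth F v ≡ 0
  breadthFirst = record
    { root         = rt
    ; parent       = λ w → par (dp w) w (proj₁ (proj₂ (shortest w)))
    ; depth        = dp
    ; root-adj     = rt-adj
    ; depth-adj    = dp-adj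
    ; root-depth-0 = λ {w} → rt-0 (dp w) w (proj₁ (proj₂ (shortest w)))
    ; parent-adj   = λ {w} → par-adj (dp w) w (proj₁ (proj₂ (shortest w)))
    ; parent-root  = λ {w} → par-root (dp w) w (proj₁ (proj₂ (shortest w)))
    ; depth-parent = λ w → par-depth (dp w) w (proj₁ (proj₂ (shortest w))) refl
    } , ℕ.n≤0⇒n≡0 (dp-min 0 rep-v)

-- Nontree edges as bridges of the dual graph

module Edges {n : ℕ} (G : SimpleGraph n) where
  open SimpleGraph G

  orient : Fin n × Fin n → Fin n × Fin n
  orient (u , w) with u <? w
  ... | yes _ = u , w
  ... | no  _ = w , u

  orient-cases : ∀ d → orient d ≡ d ⊎ orient d ≡ swap d
  orient-cases (u , w) with u <? w
  ... | yes _ = inj₁ refl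
  ... | no  _ = inj₂ refl

  orient-∈ : ∀ {u w} → u ~ w → orient (u , w) ∈ˡ edges
  orient-∈ {u} {w} u~w with u <? w
  ... | yes u<w = ∈-filter⁺ _ (∈-cartesianProduct⁺ (∈-allFin u) (∈-allFin w)) (u<w , u~w)
  ... | no u≮w with <-cmp u w
  ...   | tri< u<w _ _ = contradiction u<w u≮w
  ...   | tri≈ _ u≡w _ = contradiction u~w (~-irrefl u≡w)
  ...   | tri> _ _ w<u =
    ∈-filter⁺ _ (∈-cartesianProduct⁺ (∈-allFin w) (∈-allFin u)) (w<u , ~-sym u~w)

  orient-≡ : ∀ {d e} → orient d ≡ orient e → d ≡ e ⊎ d ≡ swap e
  orient-≡ {d} {e} eq with orient-cases d | orient-cases e
  ... | inj₁ p | inj₁ q = inj₁ (trans (sym p) (trans eq q))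
  ... | inj₁ p | inj₂ q = inj₂ (trans (sym p) (trans eq q))
  ... | inj₂ p | inj₁ q = inj₂ (cong swap (trans (sym p) (trans eq q)))
  ... | inj₂ p | inj₂ q = inj₁ (cong swap (trans (sym p) (trans eq q)))

  isolated-component : ∀ {u w} → u ∈ˡ isolatedVertices → Connected u w → u ≡ w
  isolated-component u∈ ε         = refl
  isolated-component u∈ (u~x ◅ _) =
    contradiction (_ , u~x) (proj₂ (∈-filter⁻ (λ v → ¬? (any? (v ~?_))) {xs = allFin n} u∈))

  -- Vertices with a neighbour in distinct components and the isolated vertices all lie in different
  -- components. Isolated vertices are counted apart because faces are orbits of darts and miss
  -- them.
  count-components : ∀ {C k} → HasClasses Connected C → (t : Fin k → Fin n) →
    (∀ j → ∃[ w ] t j ~ w) → (∀ {i j} → Connected (t i) (t j) → i ≡ j) →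
    k + length isolatedVertices ≤ⁿ C
  count-components {C} {k} components t t~ t-injective =
    injective⇒≤ {f = λ i → class (vertex (splitAt k i))}
      λ {x} {y} eq → trans (sym (Fin.join-splitAt k _ x))
        (trans (cong (join k _) (vertex-injective (splitAt k x) (splitAt k y)
                                 (Equivalence.to (class-kernel _ _) eq)))
               (Fin.join-splitAt k _ y))
    where
    open HasClasses components
    vertex : Fin k ⊎ Fin (length isolatedVertices) → Fin n
    vertex (inj₁ j) = t j
    vertex (inj₂ i) = lookup isolatedVertices i
    isolated : ∀ i → lookup isolatedVertices i ∈ˡ isolatedVertices
    isolated i = ∈-lookup {xs = isolatedVertices} i
    no-edge : ∀ i j → lookup isolatedVertices i ≢ t j
    no-edge i j eq = proj₂ (∈-filter⁻ (λ v → ¬? (any? (v ~?_))) {xs = allFin n} (isolated i))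
                           (subst (λ u → ∃[ w ] u ~ w) (sym eq) (t~ j))
    vertex-injective : ∀ x y → Connected (vertex x) (vertex y) → x ≡ y
    vertex-injective (inj₁ i) (inj₁ j) c = cong inj₁ (t-injective c)
    vertex-injective (inj₁ i) (inj₂ j) c =
      contradiction (isolated-component (isolated j) (Equivalence.to (class-kernel _ _)
        (sym (Equivalence.from (class-kernel _ _) c)))) (no-edge j i)
    vertex-injective (inj₂ i) (inj₁ j) c =
      contradiction (isolated-component (isolated i) c) (no-edge i j)
    vertex-injective (inj₂ i) (inj₂ j) c =
      cong inj₂ (lookup-injective (filter⁺ _ (allFin⁺ n)) (isolated-component (isolated i) c))

module FaceLabels {n : ℕ} (G : SimpleGraph n) (pl : Planar G) where
  open SimpleGraph G
  open Planar pl
  open RotationSystem rotationSystem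
  open Darts G rotationSystem
  open HasClasses faces

  -- The value f₀ at pairs that are not darts is junk.
  face : Fin #faces → Fin n × Fin n → Fin #faces
  face f₀ (u , w) with u ~? w
  ... | yes u~w = class ((u , w) , u~w)
  ... | no  _   = f₀

  face-class : ∀ {f₀ d} (p : IsDart d) → face f₀ d ≡ class (d , p)
  face-class {f₀} {u , w} p with u ~? w
  ... | yes u~w = Equivalence.from (class-kernel _ _) (0 , refl)
  ... | no  u≁w = contradiction p u≁w

  face-next : ∀ {f₀ d} → IsDart d → face f₀ d ≡ face f₀ (nextDart d)
  face-next p = trans (face-class p)
    (trans (Equivalence.from (class-kernel _ _) (1 , refl)) (sym (face-class (nextDart-dart p))))

module Dual {n : ℕ} (G : SimpleGraph n) (pl : Planar G)
            (F : Darts.Forest G (Planar.rotationSystem pl)) where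
  open SimpleGraph G
  open Planar pl
  open RotationSystem rotationSystem
  open Edges G
  open Darts G rotationSystem
  open Forest F
  open FaceLabels G pl
  private
    module Faces = HasClasses faces
    module Components = HasClasses components

  root-connected : ∀ {u w} → Connected u w → root u ≡ root w
  root-connected ε         = refl
  root-connected (u~x ◅ c) = trans (root-adj u~x) (root-connected c)

  -- A root is charged to its component, any other vertex to the edge to its parent. Two vertices
  -- sharing such an edge would be each other's parents, against their depths.
  vertices≤ : n ≤ⁿ #components + length (filter tree? edges)
  vertices≤ = injective⇒≤ {f = λ w → join _ _ (f w (depth w ℕ.≟ 0))}
                λ {w} {w′} eq → f-injective w w′ (depth w ℕ.≟ 0) (depth w′ ℕ.≟ 0) (join-injective eq)
    where
    treeEdge : ∀ {w} → depth w ≢ 0 → orient (w , parent w) ∈ˡ filter tree? edges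
    treeEdge {w} dw with orient-cases (w , parent w)
    ... | inj₁ eq = ∈-filter⁺ tree? (orient-∈ (parent-adj dw)) (subst Tree (sym eq) (inj₁ refl))
    ... | inj₂ eq = ∈-filter⁺ tree? (orient-∈ (parent-adj dw)) (subst Tree (sym eq) (inj₂ refl))
    f : ∀ w → Dec (depth w ≡ 0) → Fin #components ⊎ Fin (length (filter tree? edges))
    f w (yes _)  = inj₁ (Components.class w)
    f w (no dw) = inj₂ (index (treeEdge dw))
    f-injective : ∀ w w′ p p′ → f w p ≡ f w′ p′ → w ≡ w′
    f-injective w w′ (yes dw) (yes dw′) eq =
      trans (sym (root-depth-0 dw)) (trans
        (root-connected (Equivalence.to (Components.class-kernel _ _) (inj₁-injective eq)))
        (root-depth-0 dw′))
    f-injective w w′ (no dw) (no dw′) eq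
      with orient-≡ {w , parent w} {w′ , parent w′}
             (index-injective (treeEdge dw) (treeEdge dw′) (inj₂-injective eq))
    ... | inj₁ e = cong proj₁ e
    ... | inj₂ e =
      contradiction (trans (depth-child (parent-adj dw) refl)
        (cong suc (trans (cong depth (cong proj₂ e))
          (depth-child (parent-adj dw′) refl))))
        λ loop → ℕ.m≢1+n+m _ {1} (trans (cong depth (sym (cong proj₁ e))) loop)

  -- If identifying faces across all nontree edges but one left the two sides
  -- of that edge identified, there would be more faces than Euler's formula allows.
  nontree-bridge : ∀ {d} → IsDart d → ¬ Tree d → Σ[ β ∈ (Fin n × Fin n → Bool) ]
    ((∀ {e} → IsDart e → β e ≡ β (nextDart e)) ×
     (∀ {e} → IsDart e → ¬ Tree e → e ≢ d → e ≢ swap d → β e ≡ β (swap e)) ×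
     β d ≡ false × β (swap d) ≡ true)
  nontree-bridge {d} d-dart d-nontree =
    (λ e → not (does (label d ≟ label e))) ,
    (λ e → cong (λ l → not (does (label d ≟ l))) (label-next e)) ,
    (λ e ¬t e≢d e≢d′ → cong (λ l → not (does (label d ≟ l))) (label-flip e ¬t e≢d e≢d′)) ,
    cong not (dec-true (label d ≟ label d) refl) ,
    cong not (dec-false (label d ≟ label (swap d)) separated)
    where
    f₀ : Fin #faces
    f₀ = Faces.class (d , d-dart)
    nontree others : List (Fin n × Fin n)
    nontree = filter (¬? ∘ tree?) edges
    others  = filter (λ e → ¬? (e ≟ᵈ orient d)) nontree
    identifications : List (Fin #faces × Fin #faces)
    identifications = map (λ e → face f₀ e , face f₀ (swap e)) others
    classes = quotient identifications
    k = proj₁ classes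
    label : Fin n × Fin n → Fin k
    label e = proj₁ (proj₂ classes) (face f₀ e)
    label-next : ∀ {e} → IsDart e → label e ≡ label (nextDart e)
    label-next p = cong (proj₁ (proj₂ classes)) (face-next p)
    ∈-nontree : ∀ {e} → IsDart e → ¬ Tree e → orient e ∈ˡ nontree
    ∈-nontree {e} p ¬t = ∈-filter⁺ (¬? ∘ tree?) (orient-∈ p) (orient-nontree (orient-cases e))
      where
      orient-nontree : orient e ≡ e ⊎ orient e ≡ swap e → ¬ Tree (orient e)
      orient-nontree (inj₁ eq) t = ¬t (subst Tree eq t)
      orient-nontree (inj₂ eq) t = ¬t (Tree-swap (subst Tree eq t))
    label-flip : ∀ {e} → IsDart e → ¬ Tree e → e ≢ d → e ≢ swap d → label e ≡ label (swap e)
    label-flip {e} p ¬t e≢d e≢d′ = case′ (orient-cases e)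
      where
      e∈ : orient e ∈ˡ others
      e∈ = ∈-filter⁺ (λ e → ¬? (e ≟ᵈ orient d)) (∈-nontree p ¬t) λ eq → differ (orient-≡ {e} {d} eq)
        where
        differ : ¬ (e ≡ d ⊎ e ≡ swap d)
        differ (inj₁ eq) = e≢d eq
        differ (inj₂ eq) = e≢d′ eq
      same : label (orient e) ≡ label (swap (orient e))
      same = All.lookup (proj₁ (proj₂ (proj₂ (proj₂ classes))))
                        (∈-map⁺ (λ e → face f₀ e , face f₀ (swap e)) e∈)
      case′ : orient e ≡ e ⊎ orient e ≡ swap e → label e ≡ label (swap e)
      case′ (inj₁ eq) = subst (λ x → label x ≡ label (swap x)) eq same
      case′ (inj₂ eq) = sym (subst (λ x → label x ≡ label (swap x)) eq same)
    separated : label d ≢ label (swap d)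
    separated eq = ℕ.<⇒≢ violation euler
      where
      flip : ∀ {e} → IsDart e → ¬ Tree e → label e ≡ label (swap e)
      flip {e} p ¬t with e ≟ᵈ d | e ≟ᵈ swap d
      ... | yes refl | _        = eq
      ... | no _     | yes refl = sym eq
      ... | no e≢d   | no e≢d′  = label-flip p ¬t e≢d e≢d′
      dart : Fin k → Dart
      dart j = proj₁ (Faces.class-surjective (proj₁ (proj₁ (proj₂ (proj₂ classes)) j)))
      label-dart : ∀ j → label (proj₁ (dart j)) ≡ j
      label-dart j = trans
        (cong (proj₁ (proj₂ classes)) (trans (face-class (proj₂ (dart j)))
          (proj₂ (Faces.class-surjective (proj₁ (proj₁ (proj₂ (proj₂ classes)) j))))))
        (proj₂ (proj₁ (proj₂ (proj₂ classes)) j))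
      -- If the two sides of `d` carried the same label, labels would agree across every nontree
      -- edge and so be constant on components. Different labels then sit in different components.
      components≥ : k + length isolatedVertices ≤ⁿ #components
      components≥ = count-components components (λ j → proj₁ (proj₁ (dart j)))
        (λ j → _ , proj₂ (dart j))
        λ {i} {j} c → trans (sym (label-dart i)) (trans
          (nontree-component-constant label label-next flip c (proj₂ (dart i)) (proj₂ (dart j)))
          (label-dart j))
      others< : length others < length nontree
      others< = filter-notAll (λ e → ¬? (e ≟ᵈ orient d)) nontree
        (lose (∈-nontree d-dart d-nontree) λ ≢ → ≢ refl)
      T = length (filter tree? edges)
      I = length isolatedVertices
      open ℕ.≤-Reasoning
      violation : n + (#faces + I) < length edges + 2 * #components
      violation = begin-strict
        n + (#faces + I)
          ≤⟨ ℕ.+-mono-≤ vertices≤ (ℕ.+-monoˡ-≤ I (proj₂ (proj₂ (proj₂ (proj₂ classes))))) ⟩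
        #components + T + (k + length identifications + I)
          ≡⟨ cong (λ o → #components + T + (k + o + I)) (length-map _ others) ⟩
        #components + T + (k + length others + I)
          ≡⟨ regroup #components T k (length others) I ⟩
        #components + T + length others + (k + I)
          ≤⟨ ℕ.+-monoʳ-≤ _ components≥ ⟩
        #components + T + length others + #components
          <⟨ ℕ.+-monoˡ-< #components (ℕ.+-monoʳ-< (#components + T) others<) ⟩
        #components + T + length nontree + #components
          ≡⟨ regroup′ #components T (length nontree) ⟩
        T + length nontree + 2 * #components
          ≡⟨ cong (_+ 2 * #components) (length-filter-¬ tree? edges) ⟨
        length edges + 2 * #components ∎
        where
        regroup : ∀ c t k o i → c + t + (k + o + i) ≡ c + t + o + (k + i)
        regroup = solve-∀
        regroup′ : ∀ c t m → c + t + m + c ≡ t + m + 2 * c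
        regroup′ = solve-∀

-- Regions bounded by two tree paths

-- Counts all pairs of vertices, darts or not; it is the measure that makes the descent to a
-- smallest region terminate.
size : ∀ {n} → (Fin n × Fin n → Bool) → ℕ
size {n} σ = ∣ tabulate (λ i → σ (remQuot n i)) ∣

size-mono-< : ∀ {n} {σ τ : Fin n × Fin n → Bool} →
  (∀ e → σ e ≡ true → τ e ≡ true) → ∀ e → τ e ≡ true → σ e ≡ false → size σ < size τ
size-mono-< {n} {σ} {τ} σ⊆τ e@(i , j) τe σe = p⊂q⇒∣p∣<∣q∣
  {p = tabulate (λ i → σ (remQuot n i))} {q = tabulate (λ i → τ (remQuot n i))}
  ( (λ {x} x∈ → lookup⇒[]= x _ (trans (lookup∘tabulate _ x)
      (σ⊆τ (remQuot n x) (trans (sym (lookup∘tabulate _ x)) ([]=⇒lookup x∈)))))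
  , combine i j
  , lookup⇒[]= (combine i j) _ (trans (lookup∘tabulate _ (combine i j))
      (trans (cong τ (remQuot-combine i j)) τe))
  , λ x∈ → case trans (sym σe) (trans (cong σ (sym (remQuot-combine i j)))
             (trans (sym (lookup∘tabulate _ (combine i j))) ([]=⇒lookup x∈))) of λ () )

majority : Bool → Bool → Bool → Bool
majority x y z = if x then y ∨ z else y ∧ z

majority-not : ∀ x y z → majority (not x) (not y) (not z) ≡ not (majority x y z)
majority-not false false z = refl
majority-not false true  z = refl
majority-not true  false z = refl
majority-not true  true  z = refl

majority-two : ∀ {x y z} → majority x y z ≡ true →
  (x ≡ true × y ≡ true) ⊎ (x ≡ true × z ≡ true) ⊎ (y ≡ true × z ≡ true)
majority-two {false} {true} {true}  _ = inj₂ (inj₂ (refl , refl))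
majority-two {true}  {true}         _ = inj₁ (refl , refl)
majority-two {true}  {false} {true} _ = inj₂ (inj₁ (refl , refl))

module Regions {n : ℕ} (G : SimpleGraph n) (pl : Planar G)
               (F : Darts.Forest G (Planar.rotationSystem pl)) where
  open SimpleGraph G
  open Planar pl using (rotationSystem; faces)
  open RotationSystem rotationSystem
  open Darts G rotationSystem
  open Forest F
  open Dual G pl F

  private
    variable
      a b f g : Fin n × Fin n
      σ τ     : Fin n × Fin n → Bool

  SameFace-sym : IsDart f → IsDart g → ∃[ k ] iterate nextDart f k ≡ g →
                 ∃[ k ] iterate nextDart g k ≡ f
  SameFace-sym {f} {g} p q s = Equivalence.to (class-kernel (g , q) (f , p))
                                 (sym (Equivalence.from (class-kernel (f , p) (g , q)) s))
    where open HasClasses faces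

  -- One side of the closed curve formed by the tree paths to the heads of a and b
  -- and a chord joining the corners behind a and b inside a common face.
  record Region (a b : Fin n × Fin n) (σ : Fin n × Fin n → Bool) : Set where
    field
      a-dart     : IsDart a
      b-dart     : IsDart b
      flip       : ∀ {d} → IsDart d → ¬ Tree d → σ d ≡ σ (swap d)
      next       : ∀ {d} → IsDart d → d ≢ a → d ≢ b → σ d ≡ σ (nextDart d)
      a-outside  : σ a ≡ false
      a′-inside  : σ (nextDart a) ≡ true
      b-inside   : σ b ≡ true
      b′-outside : σ (nextDart b) ≡ false
  open Region

  _∖_ : (Fin n × Fin n → Bool) → Fin n × Fin n → Fin n × Fin n → Bool
  (σ ∖ d) e = σ e ∧ not (does (e ≟ᵈ d))

  ∖-here : ∀ σ d → (σ ∖ d) d ≡ false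
  ∖-here σ d = trans (cong (λ x → σ d ∧ not x) (dec-true (d ≟ᵈ d) refl)) (∧-zeroʳ (σ d))

  ∖-other : ∀ σ {d e} → e ≢ d → (σ ∖ d) e ≡ σ e
  ∖-other σ {d} {e} e≢d =
    trans (cong (λ x → σ e ∧ not x) (dec-false (e ≟ᵈ d) e≢d)) (∧-identityʳ (σ e))

  ∖-false : ∀ σ d {e} → σ e ≡ false → (σ ∖ d) e ≡ false
  ∖-false σ d {e} eq = cong (_∧ not (does (e ≟ᵈ d))) eq

  ∖-⊆ : ∀ σ d e → (σ ∖ d) e ≡ true → σ e ≡ true
  ∖-⊆ σ d e eq with σ e
  ... | true = refl

  swap≢ : IsDart f → swap f ≢ f
  swap≢ p eq = ~⇒≢ p (sym (cong proj₁ eq))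

  bool-≢ : ∀ {x y : Fin n × Fin n} → σ x ≡ true → σ y ≡ false → x ≢ y
  bool-≢ p q refl with () ← trans (sym p) q

  insert : (Fin n × Fin n → Bool) → Fin n × Fin n → Fin n × Fin n → Bool
  insert σ d e = σ e ∨ does (e ≟ᵈ d)

  insert-here : ∀ σ d → insert σ d d ≡ true
  insert-here σ d = trans (cong (σ d ∨_) (dec-true (d ≟ᵈ d) refl)) (∨-zeroʳ (σ d))

  insert-other : ∀ σ {d e} → e ≢ d → insert σ d e ≡ σ e
  insert-other σ {d} {e} e≢d =
    trans (cong (σ e ∨_) (dec-false (e ≟ᵈ d) e≢d)) (∨-identityʳ (σ e))

  -- The chord joins the corners before and after `d`, so it runs alongside `d`. If `d` is a tree
  -- edge, chord and tree enclose only the strip of `d`. Otherwise the curve is parallel to the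
  -- fundamental cycle of `d`: the bridge property labels the far side of the edge, and inserting
  -- `d` adds the strip between edge and chord.
  cut : ∀ {a} → IsDart a → ∃ (Region a (nextDart a))
  cut {a} p = go (tree? d)
    where
    d = nextDart a
    d-dart = nextDart-dart p
    a≢d : a ≢ d
    a≢d eq = nextDart≢ p (sym eq)
    next≢d : ∀ {e} → IsDart e → e ≢ a → nextDart e ≢ d
    next≢d q e≢a eq = e≢a (nextDart-injective q p eq)
    go : Dec (Tree d) → ∃ (Region a d)
    go (yes t) = insert (λ _ → false) d , record
      { a-dart = p ; b-dart = d-dart
      ; flip = λ {e} q ¬t → trans
          (insert-other (λ _ → false) {d} {e} (λ { refl → ¬t t }))
          (sym (insert-other (λ _ → false) {d} {swap e} (λ eq → ¬t (Tree-swap (subst Tree (sym eq) t)))))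
      ; next = λ q e≢a e≢d → trans (insert-other (λ _ → false) e≢d)
                                   (sym (insert-other (λ _ → false) (next≢d q e≢a)))
      ; a-outside  = insert-other (λ _ → false) a≢d
      ; a′-inside  = insert-here (λ _ → false) d
      ; b-inside   = insert-here (λ _ → false) d
      ; b′-outside = insert-other (λ _ → false) (nextDart≢ d-dart)
      }
    go (no ¬t) with nontree-bridge d-dart ¬t
    ... | β , β-next , β-flip , βd , βd′ = insert β d , record
      { a-dart = p ; b-dart = d-dart
      ; flip = flip′
      ; next = λ q e≢a e≢d → trans (insert-other β e≢d)
                               (trans (β-next q) (sym (insert-other β (next≢d q e≢a))))
      ; a-outside  = trans (insert-other β a≢d) (trans (β-next p) βd)
      ; a′-inside  = insert-here β d
      ; b-inside   = insert-here β d
      ; b′-outside = trans (insert-other β (nextDart≢ d-dart)) (trans (sym (β-next d-dart)) βd)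
      }
      where
      d′-inside : insert β d (swap d) ≡ true
      d′-inside = trans (insert-other β (swap≢ d-dart)) βd′
      flip′ : ∀ {e} → IsDart e → ¬ Tree e → insert β d e ≡ insert β d (swap e)
      flip′ {e} q ¬t = by (e ≟ᵈ d) (e ≟ᵈ swap d)
        where
        by : Dec (e ≡ d) → Dec (e ≡ swap d) → insert β d e ≡ insert β d (swap e)
        by (yes refl) _          = trans (insert-here β d) (sym d′-inside)
        by (no _)     (yes refl) = trans d′-inside (sym (insert-here β d))
        by (no e≢d)   (no e≢d′)  = trans (insert-other β e≢d) (trans (β-flip q ¬t e≢d e≢d′)
                                     (sym (insert-other β (λ eq → e≢d′ (cong swap eq)))))

  complement : Region a b σ → Region b a (not ∘ σ)
  complement r = record
    { a-dart = b-dart r ; b-dart = a-dart r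
    ; flip       = λ p ¬t → cong not (flip r p ¬t)
    ; next       = λ p ≢b ≢a → cong not (next r p ≢a ≢b)
    ; a-outside  = cong not (b-inside r)
    ; a′-inside  = cong not (b′-outside r)
    ; b-inside   = cong not (a-outside r)
    ; b′-outside = cong not (a′-inside r)
    }

  -- The third corner is the one after `d`, the first dart inside. Its chord to the corner after `a`
  -- cuts the region in two. Intersecting with `σ` avoids having to show that `τ` lies within `σ`.
  module Split (r : Region a b σ) (s : Region a (nextDart a) τ) (d≢b : nextDart a ≢ b)
               (same : ∃[ k ] iterate nextDart a k ≡ b) where

    private
      d = nextDart a
      φd-inside : σ (nextDart d) ≡ true
      φd-inside = trans
        (sym (next r (b-dart s) (bool-≢ {σ} (a′-inside r) (a-outside r)) d≢b)) (a′-inside r)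

    -- From d onwards the face stays in σ until it reaches b, so it cannot re-enter τ before.
    b-outside : τ b ≡ false
    b-outside = start (proj₁ same) (proj₂ same)
      where
      walk : ∀ k {e} → IsDart e → σ e ≡ true → τ e ≡ false → iterate nextDart e k ≡ b → τ b ≡ false
      walk zero p σe τe refl = τe
      walk (suc k) {e} p σe τe eq with e ≟ᵈ b
      ... | yes refl = τe
      ... | no e≢b   = walk k (nextDart-dart p)
        (trans (sym (next r p (bool-≢ {σ} σe (a-outside r)) e≢b)) σe)
        (trans (sym (next s p (bool-≢ {σ} σe (a-outside r))
                              (λ e≡d → bool-≢ {τ} (b-inside s) τe (sym e≡d)))) τe)
        eq
      start : ∀ k → iterate nextDart a k ≡ b → τ b ≡ false
      start zero eq = contradiction (sym eq) (bool-≢ {σ} (b-inside r) (a-outside r))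
      start (suc zero) eq = contradiction eq d≢b
      start (suc (suc k)) eq = walk k (nextDart-dart (b-dart s)) φd-inside (b′-outside s) eq

    first : Region a d (λ e → σ e ∧ τ e)
    first = record
      { a-dart = a-dart r ; b-dart = b-dart s
      ; flip       = λ p ¬t → cong₂ _∧_ (flip r p ¬t) (flip s p ¬t)
      ; next       = next′
      ; a-outside  = cong (_∧ τ a) (a-outside r)
      ; a′-inside  = cong₂ _∧_ (a′-inside r) (a′-inside s)
      ; b-inside   = cong₂ _∧_ (a′-inside r) (a′-inside s)
      ; b′-outside = trans (cong (σ (nextDart d) ∧_) (b′-outside s)) (∧-zeroʳ _)
      }
      where
      next′ : ∀ {e} → IsDart e → e ≢ a → e ≢ d → σ e ∧ τ e ≡ σ (nextDart e) ∧ τ (nextDart e)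
      next′ {e} p e≢a e≢d with e ≟ᵈ b
      ... | yes refl = trans (cong (σ b ∧_) b-outside)
                         (trans (∧-zeroʳ (σ b)) (cong (_∧ τ (nextDart b)) (sym (b′-outside r))))
      ... | no e≢b   = cong₂ _∧_ (next r p e≢a e≢b) (next s p e≢a e≢d)

    second : Region d b (λ e → σ e ∧ not (τ e))
    second = record
      { a-dart = b-dart s ; b-dart = b-dart r
      ; flip       = λ p ¬t → cong₂ (λ x y → x ∧ not y) (flip r p ¬t) (flip s p ¬t)
      ; next       = next′
      ; a-outside  = trans (cong (λ x → σ d ∧ not x) (a′-inside s)) (∧-zeroʳ (σ d))
      ; a′-inside  = cong₂ (λ x y → x ∧ not y) φd-inside (b′-outside s)
      ; b-inside   = cong₂ (λ x y → x ∧ not y) (b-inside r) b-outside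
      ; b′-outside = cong (_∧ not (τ (nextDart b))) (b′-outside r)
      }
      where
      next′ : ∀ {e} → IsDart e → e ≢ d → e ≢ b →
              σ e ∧ not (τ e) ≡ σ (nextDart e) ∧ not (τ (nextDart e))
      next′ {e} p e≢d e≢b with e ≟ᵈ a
      ... | yes refl = trans (cong (_∧ not (τ a)) (a-outside r))
                         (sym (trans (cong (λ x → σ d ∧ not x) (a′-inside s)) (∧-zeroʳ (σ d))))
      ... | no e≢a   = cong₂ (λ x y → x ∧ not y) (next r p e≢a e≢b) (next s p e≢a e≢d)

  module Shrink (r : Region a (nextDart a) σ) where

    private
      d = nextDart a

    -- `d` is the only dart of its face on the inner side of the chord. Without it the chord has
    -- nothing left to separate, and the labelling becomes constant on faces.
    shrink-next : ∀ {e} → IsDart e → (σ ∖ d) e ≡ (σ ∖ d) (nextDart e)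
    shrink-next {e} p = by (e ≟ᵈ a) (e ≟ᵈ d)
      where
      by : Dec (e ≡ a) → Dec (e ≡ d) → (σ ∖ d) e ≡ (σ ∖ d) (nextDart e)
      by (yes refl) _          = trans (∖-false σ d (a-outside r)) (sym (∖-here σ d))
      by (no _)     (yes refl) = trans (∖-here σ d) (sym (∖-false σ d (b′-outside r)))
      by (no e≢a)   (no e≢d)   = trans (∖-other σ e≢d) (trans (next r p e≢a e≢d)
        (sym (∖-other σ (λ eq → e≢a (nextDart-injective p (a-dart r) eq)))))

    -- Deleting a tree dart leaves nontree edges respected, so the labelling without `d` is constant
    -- on the component, with the value false that it takes at `d`.
    inside-tree : Tree d → Connected (proj₁ d) (proj₁ g) → IsDart g → σ g ≡ true → g ≡ d
    inside-tree {g} t c p σg with g ≟ᵈ d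
    ... | yes eq = eq
    ... | no g≢d = contradiction refl (bool-≢ {σ ∖ d} (trans (∖-other σ g≢d) σg) outside)
      where
      flip′ : ∀ {e} → IsDart e → ¬ Tree e → (σ ∖ d) e ≡ (σ ∖ d) (swap e)
      flip′ q ¬t = trans (∖-other σ (λ { refl → ¬t t })) (trans (flip r q ¬t)
        (sym (∖-other σ (λ eq → ¬t (Tree-swap (subst Tree (sym eq) t))))))
      outside : (σ ∖ d) g ≡ false
      outside = trans (sym (nontree-component-constant (σ ∖ d) shrink-next flip′ c (b-dart r) p))
                      (∖-here σ d)

    -- The chord is pushed across the edge `d` into the face on its other side, keeping its two end
    -- vertices. Both darts of the edge leave the region together, so the labelling still agrees
    -- across it.
    beyond : ¬ Tree d → IsDart b → nextDart b ≡ swap d → Region (swap d) b ((σ ∖ d) ∖ swap d)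
    beyond {b} ¬t q φb = record
      { a-dart = d′-dart ; b-dart = q
      ; flip       = flip′
      ; next       = next′
      ; a-outside  = ∖-here (σ ∖ d) (swap d)
      ; a′-inside  = trans (∖-other (σ ∖ d) (nextDart≢ d′-dart))
                       (trans (sym (shrink-next d′-dart)) d′-inside)
      ; b-inside   = trans (∖-other (σ ∖ d) (λ { refl → nextDart≢ q φb }))
                       (trans (shrink-next q) (trans (cong (σ ∖ d) φb) d′-inside))
      ; b′-outside = trans (cong ((σ ∖ d) ∖ swap d) φb) (∖-here (σ ∖ d) (swap d))
      }
      where
      d′-dart : IsDart (swap d)
      d′-dart = ~-sym (b-dart r)
      d′-inside : (σ ∖ d) (swap d) ≡ true
      d′-inside = trans (∖-other σ (swap≢ (b-dart r))) (trans (sym (flip r (b-dart r) ¬t)) (b-inside r))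
      next′ : ∀ {e} → IsDart e → e ≢ swap d → e ≢ b →
              ((σ ∖ d) ∖ swap d) e ≡ ((σ ∖ d) ∖ swap d) (nextDart e)
      next′ p e≢d′ e≢b = trans (∖-other (σ ∖ d) e≢d′) (trans (shrink-next p)
        (sym (∖-other (σ ∖ d) (λ eq → e≢b (nextDart-injective p q (trans eq (sym φb)))))))
      flip′ : ∀ {e} → IsDart e → ¬ Tree e →
              ((σ ∖ d) ∖ swap d) e ≡ ((σ ∖ d) ∖ swap d) (swap e)
      flip′ {e} p ¬t′ = by (e ≟ᵈ d) (e ≟ᵈ swap d)
        where
        by : Dec (e ≡ d) → Dec (e ≡ swap d) →
             ((σ ∖ d) ∖ swap d) e ≡ ((σ ∖ d) ∖ swap d) (swap e)
        by (yes refl) _          =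
          trans (∖-false (σ ∖ d) (swap d) (∖-here σ d)) (sym (∖-here (σ ∖ d) (swap d)))
        by (no _)     (yes refl) =
          trans (∖-here (σ ∖ d) (swap d)) (sym (∖-false (σ ∖ d) (swap d) (∖-here σ d)))
        by (no e≢d)   (no e≢d′)  =
          trans (trans (∖-other (σ ∖ d) e≢d′) (∖-other σ e≢d)) (trans (flip r p ¬t′)
            (sym (trans (∖-other (σ ∖ d) (λ eq → e≢d (cong swap eq)))
                        (∖-other σ (λ eq → e≢d′ (cong swap eq))))))

  record Trisection (minority : (Fin n × Fin n → Bool) → Set) : Set where
    field
      {x y z}       : Fin n × Fin n
      {ρ₁ ρ₂ ρ₃}    : Fin n × Fin n → Bool
      region₁       : Region x y ρ₁
      region₂       : Region y z ρ₂
      region₃       : Region z x ρ₃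
      minority₁     : minority ρ₁
      minority₂     : minority ρ₂
      minority₃     : minority ρ₃
      cover         : ∀ e → ρ₁ e ≡ true ⊎ ρ₂ e ≡ true ⊎ ρ₃ e ≡ true

  module Trisect {v u₁ u₂ u₃ : Fin n} (v~u₁ : v ~ u₁) (v~u₂ : v ~ u₂) (v~u₃ : v ~ u₃)
    (u₁≢u₂ : u₁ ≢ u₂) (u₁≢u₃ : u₁ ≢ u₃) (u₂≢u₃ : u₂ ≢ u₃)
    (star : ∀ {u} → v ~ u → Tree (v , u)) where

    votes : (Fin n × Fin n → Bool) → Bool
    votes σ = majority (σ (v , u₁)) (σ (v , u₂)) (σ (v , u₃))

    Minority : (Fin n × Fin n → Bool) → Set
    Minority σ = votes σ ≡ false

    votes-cong : (∀ {u} → v ~ u → σ (v , u) ≡ τ (v , u)) → votes σ ≡ votes τ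
    votes-cong {σ} {τ} eq rewrite eq v~u₁ | eq v~u₂ | eq v~u₃ = refl

    votes-not : votes (not ∘ σ) ≡ not (votes σ)
    votes-not {σ} = majority-not (σ (v , u₁)) (σ (v , u₂)) (σ (v , u₃))

    -- A smallest region containing two of the three darts at v cannot be split further
    -- without losing that majority.
    descend : ∀ h → size σ < h → Region a b σ → ∃[ k ] iterate nextDart a k ≡ b →
              Connected v (proj₁ a) → votes σ ≡ true → Trisection Minority
    descend {σ} {a} {b} (suc h) bound r same c many with nextDart a ≟ᵈ b
    ... | no d≢b = try (votes inner) (votes outer) refl refl
      where
      d = nextDart a
      θ = proj₁ (cut (a-dart r))
      s = proj₂ (cut (a-dart r))
      open Split r s d≢b same
      inner outer : Fin n × Fin n → Bool
      inner e = σ e ∧ θ e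
      outer e = σ e ∧ not (θ e)
      ∧-left : ∀ x y → x ∧ y ≡ true → x ≡ true
      ∧-left true _ _ = refl
      covered : ∀ x y → x ∧ y ≡ true ⊎ x ∧ not y ≡ true ⊎ not x ≡ true
      covered false y     = inj₂ (inj₂ refl)
      covered true  false = inj₂ (inj₁ refl)
      covered true  true  = inj₁ refl
      same′ : ∀ k → iterate nextDart a k ≡ b → ∃[ j ] iterate nextDart d j ≡ b
      same′ zero    eq = contradiction (sym eq) (bool-≢ {σ} (b-inside r) (a-outside r))
      same′ (suc k) eq = k , eq
      try : ∀ p q → votes inner ≡ p → votes outer ≡ q → Trisection Minority
      try true q eq _ = descend h
        (ℕ.<-≤-trans (size-mono-< {σ = inner} {τ = σ} (λ e → ∧-left (σ e) (θ e)) b (b-inside r)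
          (trans (cong (σ b ∧_) b-outside) (∧-zeroʳ (σ b)))) (s≤s⁻¹ bound))
        first (1 , refl) c eq
      try false true _ eq = descend h
        (ℕ.<-≤-trans (size-mono-< {σ = outer} {τ = σ} (λ e → ∧-left (σ e) (not (θ e))) d (a′-inside r)
          (a-outside second)) (s≤s⁻¹ bound))
        second (same′ (proj₁ same) (proj₂ same)) (c ◅◅ (a-dart r ◅ ε)) eq
      try false false eq₁ eq₂ = record
        { region₁ = first ; region₂ = second ; region₃ = complement r
        ; minority₁ = eq₁ ; minority₂ = eq₂ ; minority₃ = trans (votes-not {σ}) (cong not many)
        ; cover = λ e → covered (σ e) (θ e) }
    ... | yes refl = go (tree? d)
      where
      d = nextDart a
      open Shrink r
      d~*v : Connected (proj₁ d) v
      d~*v = reverse (c ◅◅ (a-dart r ◅ ε)) ε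
        where
        reverse : ∀ {x y z} → Connected x y → Connected x z → Connected y z
        reverse ε         acc = acc
        reverse (e ◅ p)   acc = reverse p (~-sym e ◅ acc)
      -- For a tree edge `d` is the only dart of this component inside, whereas a majority needs
      -- two.
      clash : ∀ {u u′} → v ~ u → v ~ u′ → u ≢ u′ → Tree d →
              σ (v , u) ≡ true × σ (v , u′) ≡ true → Trisection Minority
      clash p q u≢u′ t (σu , σu′) = contradiction
        (cong proj₂ (trans (inside-tree t d~*v p σu) (sym (inside-tree t d~*v q σu′)))) u≢u′
      go : Dec (Tree d) → Trisection Minority
      go (yes t) with majority-two {σ (v , u₁)} {σ (v , u₂)} {σ (v , u₃)} many
      ... | inj₁ two        = clash v~u₁ v~u₂ u₁≢u₂ t two
      ... | inj₂ (inj₁ two) = clash v~u₁ v~u₃ u₁≢u₃ t two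
      ... | inj₂ (inj₂ two) = clash v~u₂ v~u₃ u₂≢u₃ t two
      go (no ¬t) with prevDart (~-sym (b-dart r))
      ... | e , e-dart , φe = descend h
        (ℕ.<-≤-trans (size-mono-< (λ x eq → ∖-⊆ σ d x (∖-⊆ (σ ∖ d) (swap d) x eq)) d (b-inside r)
          (∖-false (σ ∖ d) (swap d) (∖-here σ d))) (s≤s⁻¹ bound))
        (beyond ¬t e-dart φe) (SameFace-sym e-dart (~-sym (b-dart r)) (1 , φe))
        (c ◅◅ (a-dart r ◅ b-dart r ◅ ε))
        -- The edges at `v` are tree edges, so neither of the two deleted darts starts at `v` and no
        -- vote is lost.
        (trans (votes-cong {(σ ∖ d) ∖ swap d} {σ} (λ v~u → trans
          (∖-other (σ ∖ d) (λ eq → ¬t (Tree-swap (subst Tree eq (star v~u)))))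
          (∖-other σ (λ eq → ¬t (subst Tree eq (star v~u)))))) many)

    trisection : Trisection Minority
    trisection = start (votes σ₀) refl
      where
      a₀ = u₁ , v
      σ₀ = proj₁ (cut (~-sym v~u₁))
      r₀ = proj₂ (cut (~-sym v~u₁))
      start : ∀ p → votes σ₀ ≡ p → Trisection Minority
      start true  eq = descend _ ℕ.≤-refl r₀ (1 , refl) (v~u₁ ◅ ε) eq
      start false eq = descend _ ℕ.≤-refl (complement r₀)
        (SameFace-sym (a-dart r₀) (b-dart r₀) (1 , refl)) ε
        (trans (votes-not {σ₀}) (cong not eq))

-- Defending a region

∣p∪q∣≤∣p∣+∣q∣ : ∀ {n} (p q : Subset n) → ∣ p ∪ q ∣ ≤ⁿ ∣ p ∣ + ∣ q ∣
∣p∪q∣≤∣p∣+∣q∣ []          []          = z≤n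
∣p∪q∣≤∣p∣+∣q∣ (true  ∷ p) (true  ∷ q) =
  s≤s (ℕ.≤-trans (∣p∪q∣≤∣p∣+∣q∣ p q) (ℕ.+-monoʳ-≤ ∣ p ∣ (ℕ.n≤1+n ∣ q ∣)))
∣p∪q∣≤∣p∣+∣q∣ (true  ∷ p) (false ∷ q) = s≤s (∣p∪q∣≤∣p∣+∣q∣ p q)
∣p∪q∣≤∣p∣+∣q∣ (false ∷ p) (true  ∷ q) =
  ℕ.≤-trans (s≤s (∣p∪q∣≤∣p∣+∣q∣ p q)) (ℕ.≤-reflexive (sym (ℕ.+-suc ∣ p ∣ ∣ q ∣)))
∣p∪q∣≤∣p∣+∣q∣ (false ∷ p) (false ∷ q) = ∣p∪q∣≤∣p∣+∣q∣ p q

minority-unique : ∀ {n} (f : Fin n → Bool) {u₁ u₂ u₃ : Fin n} →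
  majority (f u₁) (f u₂) (f u₃) ≡ false →
  ∀ {u w} → u ≡ u₁ ⊎ u ≡ u₂ ⊎ u ≡ u₃ → w ≡ u₁ ⊎ w ≡ u₂ ⊎ w ≡ u₃ →
  f u ≡ true → f w ≡ true → u ≡ w
minority-unique f {u₁} {u₂} {u₃} few (inj₁ refl) (inj₁ refl) fu fw = refl
minority-unique f {u₁} {u₂} {u₃} few (inj₁ refl) (inj₂ (inj₁ refl)) fu fw
  rewrite fu | fw with () ← few
minority-unique f {u₁} {u₂} {u₃} few (inj₁ refl) (inj₂ (inj₂ refl)) fu fw
  rewrite fu | fw with f u₂ | few
... | true | ()
... | false | ()
minority-unique f {u₁} {u₂} {u₃} few (inj₂ (inj₁ refl)) (inj₁ refl) fu fw
  rewrite fu | fw with () ← few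
minority-unique f {u₁} {u₂} {u₃} few (inj₂ (inj₁ refl)) (inj₂ (inj₁ refl)) fu fw = refl
minority-unique f {u₁} {u₂} {u₃} few (inj₂ (inj₁ refl)) (inj₂ (inj₂ refl)) fu fw
  rewrite fu | fw with f u₁ | few
... | true | ()
... | false | ()
minority-unique f {u₁} {u₂} {u₃} few (inj₂ (inj₂ refl)) (inj₁ refl) fu fw
  rewrite fu | fw with f u₂ | few
... | true | ()
... | false | ()
minority-unique f {u₁} {u₂} {u₃} few (inj₂ (inj₂ refl)) (inj₂ (inj₁ refl)) fu fw
  rewrite fu | fw with f u₁ | few
... | true | ()
... | false | ()
minority-unique f {u₁} {u₂} {u₃} few (inj₂ (inj₂ refl)) (inj₂ (inj₂ refl)) fu fw = refl

module Fight {n : ℕ} (G : SimpleGraph n) (pl : Planar G)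
             (F : Darts.Forest G (Planar.rotationSystem pl))
             (v : Fin n) (v-depth : Darts.Forest.depth F v ≡ 0) where
  open SimpleGraph G
  open Firefighter G
  open FirefighterProperties G
  open Planar pl using (rotationSystem)
  open RotationSystem rotationSystem
  open Darts G rotationSystem
  open Forest F
  open Regions G pl F

  v-root : root v ≡ v
  v-root = root-depth-0 v-depth

  depth-0⇒v : ∀ {w} → root w ≡ v → depth w ≡ 0 → w ≡ v
  depth-0⇒v rw dw = trans (sym (root-depth-0 dw)) rw

  depth-1 : ∀ {u} → v ~ u → depth u ≡ 1
  depth-1 {u} v~u with depth u in eq | depth-adj v~u
  ... | zero  | _ = contradiction (sym (depth-0⇒v (trans (sym (root-adj v~u)) v-root) eq)) (~⇒≢ v~u)
  ... | suc k | bound = cong suc (ℕ.n≤0⇒n≡0 (ℕ.≤-trans (s≤s⁻¹ bound) (ℕ.≤-reflexive v-depth)))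

  parent-v : ∀ {u} → v ~ u → parent u ≡ v
  parent-v {u} v~u = depth-0⇒v
    (trans (sym (root-adj (parent-adj λ eq → case trans (sym eq) (depth-1 v~u) of λ ())))
           (trans (sym (root-adj v~u)) v-root))
    (trans (depth-parent u) (cong pred (depth-1 v~u)))

  up : ℕ → Fin n → Fin n
  up zero    x = x
  up (suc k) x = parent (up k x)

  depth-up : ∀ k x → depth (up k x) ≡ depth x ∸ k
  depth-up zero    x = refl
  depth-up (suc k) x = trans (depth-parent (up k x))
    (trans (cong pred (depth-up k x)) (ℕ.pred[m∸n]≡m∸[1+n] (depth x) k))

  -- The path from `x` to its root meets each depth once, so testing the ancestor at the depth of
  -- `w` decides ancestry. For `w` deeper than `x` the truncated difference is 0 and the equation
  -- fails.
  Above : Fin n → Fin n → Set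
  Above x w = up (depth x ∸ depth w) x ≡ w

  above-up : ∀ k x → k ≤ⁿ depth x → Above x (up k x)
  above-up k x k≤ = cong (λ j → up j x)
    (trans (cong (depth x ∸_) (depth-up k x)) (ℕ.m∸[m∸n]≡n k≤))

  above-refl : ∀ x → Above x x
  above-refl x = above-up 0 x z≤n

  above-parent : ∀ {x c} → Above x c → Above x (parent c)
  above-parent {x} {c} xc with depth c in eq
  ... | zero  = subst (Above x) (sym (parent-root eq))
                  (trans (cong (λ k → up (depth x ∸ k) x) eq) xc)
  ... | suc k = trans
    (cong (λ j → up j x) (trans (cong (depth x ∸_) parent-depth) (step k<depth)))
    (cong parent xc)
    where
    parent-depth : depth (parent c) ≡ k
    parent-depth = trans (depth-parent c) (cong pred eq)
    k<depth : suc k ≤ⁿ depth x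
    k<depth = ℕ.≤-trans
      (ℕ.≤-reflexive (trans (sym eq) (trans (cong depth (sym xc)) (depth-up (depth x ∸ suc k) x))))
      (ℕ.m∸n≤m (depth x) (depth x ∸ suc k))
    step : ∀ {d} → suc k ≤ⁿ d → d ∸ k ≡ suc (d ∸ suc k)
    step {suc d} k≤d = ℕ.+-∸-assoc 1 (s≤s⁻¹ k≤d)

  Wall : Fin n → Fin n → Fin n → Set
  Wall x y w = Above x w ⊎ Above y w

  wall-parent : ∀ {x y c} → Wall x y c → Wall x y (parent c)
  wall-parent (inj₁ p) = inj₁ (above-parent p)
  wall-parent (inj₂ p) = inj₂ (above-parent p)

  -- The neighbours of v reach depth 1 in round 0, so the ancestor of depth t + 1
  -- has to be protected in round t.
  module Defend (x y : Fin n) (x≢v : x ≢ v) (y≢v : y ≢ v) (σ : Fin n × Fin n → Bool)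
    (next : ∀ {u w} → u ~ w → ¬ Wall x y w → σ (u , w) ≡ σ (w , rot w u))
    (flip : ∀ {d} → IsDart d → ¬ Tree d → σ d ≡ σ (swap d))
    (guard : ∀ {w} → v ~ w → ¬ Wall x y w → σ (v , w) ≡ false) where

    wall? : ∀ w → Dec (Wall x y w)
    wall? w = (up (depth x ∸ depth w) x ≟ w) ⊎-dec (up (depth y ∸ depth w) y ≟ w)

    open Subtree σ (Wall x y) wall-parent next flip public

    strategy : Strategy
    strategy t = ⁅ up (depth x ∸ suc t) x ⁆ ∪ ⁅ up (depth y ∸ suc t) y ⁆

    -- One outside dart suffices: off the wall the label is constant around `w`, so all its darts
    -- are outside.
    Lost : Fin n → Set
    Lost w = w ≡ v ⊎ (¬ Wall x y w × ∃[ u ] (w ~ u × σ (w , u) ≡ false))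

    record Invariant (t : ℕ) (st : State) : Set where
      field
        lost : ∀ {w} → w ∈ burning st → depth w ≤ⁿ t × root w ≡ v × Lost w
        held : ∀ {w} → Wall x y w → depth w ≢ 0 → depth w ≤ⁿ t → w ∈ protected st
    open Invariant

    ∈-strategy : ∀ {w t} → Wall x y w → depth w ≡ suc t → w ∈ strategy t
    ∈-strategy {w} {t} (inj₁ p) eq = x∈p∪q⁺ (inj₁ (subst (λ z → w ∈ ⁅ z ⁆)
      (sym (trans (cong (λ k → up (depth x ∸ k) x) (sym eq)) p)) (x∈⁅x⁆ w)))
    ∈-strategy {w} {t} (inj₂ p) eq = x∈p∪q⁺ (inj₂ (subst (λ z → w ∈ ⁅ z ⁆)
      (sym (trans (cong (λ k → up (depth y ∸ k) y) (sym eq)) p)) (x∈⁅x⁆ w)))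

    invariant : ∀ t → Invariant t (run strategy (ignite v) t)
    invariant zero = record
      { lost = λ w∈ → case x∈⁅y⁆⇒x≡y v w∈ of λ { refl → ℕ.≤-reflexive v-depth , v-root , inj₁ refl }
      ; held = λ _ d≢0 d≤0 → contradiction (ℕ.n≤0⇒n≡0 d≤0) d≢0 }
    invariant (suc t) = record { lost = lost′ ; held = held′ }
      where
      st = run strategy (ignite v) t
      P′ = protected st ∪ strategy t
      held′ : ∀ {w} → Wall x y w → depth w ≢ 0 → depth w ≤ⁿ suc t → w ∈ P′
      held′ p d≢0 d≤ with ℕ.m≤n⇒m<n∨m≡n d≤
      ... | inj₁ d< = x∈p∪q⁺ (inj₁ (held (invariant t) p d≢0 (s≤s⁻¹ d<)))
      ... | inj₂ d≡ = x∈p∪q⁺ (inj₂ (∈-strategy p d≡))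
      lost′ : ∀ {w} → w ∈ spread P′ (burning st) → depth w ≤ⁿ suc t × root w ≡ v × Lost w
      lost′ {w} w∈ with ∈-spread⁻ P′ (burning st) w∈
      ... | inj₁ w∈B = let d≤ , rest = lost (invariant t) w∈B in ℕ.m≤n⇒m≤1+n d≤ , rest
      ... | inj₂ (w∉ , u , u∈ , u~w) with lost (invariant t) u∈
      ...   | d≤ , ru , lost-u = dw≤ , rw , lost-w (depth w ℕ.≟ 0) lost-u
        where
        dw≤ : depth w ≤ⁿ suc t
        dw≤ = ℕ.≤-trans (depth-adj u~w) (s≤s d≤)
        rw : root w ≡ v
        rw = trans (sym (root-adj u~w)) ru
        lost-w : Dec (depth w ≡ 0) → Lost u → Lost w
        lost-w (yes d≡0) _ = inj₁ (depth-0⇒v rw d≡0)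
        lost-w (no d≢0) lost-u = inj₂ (w∉wall , u , ~-sym u~w , false-side lost-u)
          where
          w∉wall : ¬ Wall x y w
          w∉wall p = w∉ (held′ p d≢0 dw≤)
          false-side : Lost u → σ (w , u) ≡ false
          -- The start `v` may itself be on the wall without being protected, so the fire could
          -- enter from there; `guard` excludes the inside, and uniformity at `w` reverses the dart.
          false-side (inj₁ refl) = trans
            (subst (λ z → σ (w , z) ≡ σ (z , w)) (parent-v u~w)
              (proj₂ (uniform w∉wall) (subst (w ~_) (sym (parent-v u~w)) (~-sym u~w))))
            (guard u~w w∉wall)
          false-side (inj₂ (u∉wall , u′ , u~u′ , eq)) = trans
            (sym (flip-outside u~w u∉wall w∉wall))
            (trans (proj₁ (uniform u∉wall) u~w u~u′) eq)

    -- Once the path is exhausted, truncated subtraction makes the strategy repeat `z`, which keeps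
    -- the move legal. Before that the protected ancestor has depth `suc t`, hence is not `v`.
    unburnt-guard : ∀ {z} t → z ≢ v → Above z (up (depth z ∸ suc t) z) × up (depth z ∸ suc t) z ≢ v
    unburnt-guard {z} t z≢v = above-up _ z (ℕ.m∸n≤m (depth z) (suc t)) , λ eq →
      low (depth z) refl (trans (sym (depth-up (depth z ∸ suc t) z)) (trans (cong depth eq) v-depth)) eq
      where
      low : ∀ d → d ≡ depth z → depth z ∸ (depth z ∸ suc t) ≡ 0 → up (depth z ∸ suc t) z ≢ v
      low zero    dz _  eq rewrite sym dz = z≢v eq
      low (suc d) dz d₀ eq rewrite sym dz =
        ℕ.<-irrefl refl (ℕ.≤-trans (s≤s (ℕ.m∸n≤m d t)) (ℕ.m∸n≡0⇒m≤n d₀))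

    legal : Legal 2 (ignite v) strategy
    legal t = two , unburnt
      where
      st = run strategy (ignite v) t
      two : ∣ strategy t ∣ ≤ⁿ 2
      two = ℕ.≤-trans (∣p∪q∣≤∣p∣+∣q∣ ⁅ up (depth x ∸ suc t) x ⁆ _)
              (ℕ.≤-reflexive (cong₂ _+_ (∣⁅x⁆∣≡1 (up (depth x ∸ suc t) x))
                                        (∣⁅x⁆∣≡1 (up (depth y ∸ suc t) y))))
      not-lost : ∀ {w} → Wall x y w → w ≢ v → ¬ Lost w
      not-lost p w≢v (inj₁ w≡v)       = w≢v w≡v
      not-lost p w≢v (inj₂ (¬p , _)) = ¬p p
      unburnt : ∀ {w} → w ∈ strategy t → w ∉ burning st
      unburnt {w} w∈ w∈B 
        with x∈p∪q⁻ ⁅ up (depth x ∸ suc t) x ⁆ _ w∈ | proj₂ (proj₂ (lost (invariant t) w∈B))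
      ... | inj₁ w∈x | lost-w with refl ← x∈⁅y⁆⇒x≡y (up (depth x ∸ suc t) x) w∈x =
        let p , w≢v = unburnt-guard t x≢v in not-lost (inj₁ p) w≢v lost-w
      ... | inj₂ w∈y | lost-w with refl ← x∈⁅y⁆⇒x≡y (up (depth y ∸ suc t) y) w∈y =
        let p , w≢v = unburnt-guard t y≢v in not-lost (inj₂ p) w≢v lost-w

    saved : ∀ {w} → w ≢ v → Wall x y w ⊎ (∀ {u} → w ~ u → σ (w , u) ≡ true) →
            w ∉ burning (run strategy (ignite v) n)
    saved w≢v safe w∈ with proj₂ (proj₂ (lost (invariant n) w∈)) | safe
    ... | inj₁ w≡v | _ = w≢v w≡v
    ... | inj₂ (¬p , _) | inj₁ p = ¬p p
    ... | inj₂ (_ , _ , w~u , σu) | inj₂ all with () ← trans (sym σu) (all w~u)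

  module ThreeNeighbours {u₁ u₂ u₃ : Fin n} (v~u₁ : v ~ u₁) (v~u₂ : v ~ u₂) (v~u₃ : v ~ u₃)
    (u₁≢u₂ : u₁ ≢ u₂) (u₁≢u₃ : u₁ ≢ u₃) (u₂≢u₃ : u₂ ≢ u₃)
    (neighbour : ∀ {u} → v ~ u → u ≡ u₁ ⊎ u ≡ u₂ ⊎ u ≡ u₃) where

    open Trisect v~u₁ v~u₂ v~u₃ u₁≢u₂ u₁≢u₃ u₂≢u₃ (λ v~u → inj₂ (parent-v v~u))

    -- A fixed point of a cyclic rotation would be the only neighbour of `v`.
    rot≢ : ∀ {w} → v ~ w → rot v w ≢ w
    rot≢ {w} v~w eq = u₁≢u₂ (trans (only v~u₁) (sym (only v~u₂)))
      where
      fixed : ∀ k → iterate (rot v) w k ≡ w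
      fixed zero    = refl
      fixed (suc k) = trans (cong (λ z → iterate (rot v) z k) eq) (fixed k)
      only : ∀ {u} → v ~ u → u ≡ w
      only v~u with rot-cyclic v~w v~u
      ... | k , p = trans (sym p) (fixed k)

    module Side {a b : Fin n × Fin n} {σ : Fin n × Fin n → Bool} (r : Region a b σ)
                (few : Minority σ) where
      open Region r

      -- A chord ending at v itself leaves a firefighter free in round 0 to
      -- protect the only neighbour of v that lies inside.
      inner : Fin n
      inner = if σ (v , u₁) then u₁ else if σ (v , u₂) then u₂ else u₃

      v~inner : v ~ inner
      v~inner with σ (v , u₁)
      ... | true  = v~u₁
      ... | false with σ (v , u₂)
      ...   | true  = v~u₂
      ...   | false = v~u₃

      inner-inside : ∀ {w} → v ~ w → σ (v , w) ≡ true → σ (v , inner) ≡ true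
      inner-inside v~w σw with σ (v , u₁) in eq₁
      ... | true  = eq₁
      ... | false with σ (v , u₂) in eq₂
      ...   | true  = eq₂
      ...   | false with neighbour v~w
      ...     | inj₁ refl with () ← trans (sym eq₁) σw
      ...     | inj₂ (inj₁ refl) with () ← trans (sym eq₂) σw
      ...     | inj₂ (inj₂ refl) = σw

      target : Fin n → Fin n
      target h with h ≟ v
      ... | yes _ = inner
      ... | no  _ = h

      target≢v : ∀ h → target h ≢ v
      target≢v h with h ≟ v
      ... | yes _  = λ eq → ~⇒≢ v~inner (sym eq)
      ... | no h≢v = h≢v

      target-above : ∀ h → Above (target h) h
      target-above h with h ≟ v
      ... | no _     = above-refl h
      ... | yes refl = trans (cong (λ k → up k inner) (cong₂ _∸_ (depth-1 v~inner) v-depth))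
                             (parent-v v~inner)

      target-v : target v ≡ inner
      target-v with v ≟ v
      ... | yes _  = refl
      ... | no v≢v = contradiction refl v≢v

      x y : Fin n
      x = target (proj₂ a)
      y = target (proj₂ b)

      next′ : ∀ {u w} → u ~ w → ¬ Wall x y w → σ (u , w) ≡ σ (w , rot w u)
      next′ u~w ¬p = next u~w (λ { refl → ¬p (inj₁ (target-above (proj₂ a))) })
                              (λ { refl → ¬p (inj₂ (target-above (proj₂ b))) })

      module S = Subtree σ (Wall x y) wall-parent next′ flip

      agree : ∀ {u w} → v ~ u → v ~ w → σ (v , u) ≡ true → σ (v , w) ≡ true → u ≡ w
      agree v~u v~w = minority-unique (λ u → σ (v , u)) few (neighbour v~u) (neighbour v~w)

      -- An inside neighbour `w` off the wall is the only inside one, hence `inner`. If a chord ends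
      -- at `v`, then `inner` is a target and lies on the wall. If none does, the label of `(w , v)`
      -- is that of `(v , w)` and passes the corner at `v` unchanged to `(v , rot v w)`, a second
      -- inside neighbour, which the minority forbids.
      guard : ∀ {w} → v ~ w → ¬ Wall x y w → σ (v , w) ≡ false
      guard {w} v~w ¬p with σ (v , w) in σw
      ... | false = refl
      ... | true  = contradiction refl (absurd (proj₂ a ≟ v) (proj₂ b ≟ v))
        where
        w≡inner : w ≡ inner
        w≡inner = agree v~w v~inner σw (inner-inside v~w σw)
        σw′ : σ (w , v) ≡ true
        σw′ = trans (subst (λ z → σ (w , z) ≡ σ (z , w)) (parent-v v~w)
                      (proj₂ (S.uniform ¬p) (subst (w ~_) (sym (parent-v v~w)) (~-sym v~w)))) σw
        absurd : Dec (proj₂ a ≡ v) → Dec (proj₂ b ≡ v) → w ≢ w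
        absurd (yes eq) _ _ = ¬p (inj₁ (subst (λ z → Above z w)
          (trans w≡inner (trans (sym target-v) (cong target (sym eq)))) (above-refl w)))
        absurd _ (yes eq) _ = ¬p (inj₂ (subst (λ z → Above z w)
          (trans w≡inner (trans (sym target-v) (cong target (sym eq)))) (above-refl w)))
        absurd (no a≢) (no b≢) _ = rot≢ v~w (agree (rot-adj v~w) v~w
          (trans (sym (next (~-sym v~w) (λ { refl → a≢ refl }) (λ { refl → b≢ refl }))) σw′) σw)

      open Defend x y (target≢v (proj₂ a)) (target≢v (proj₂ b)) σ next′ flip guard public

    saves-third : n ≤ⁿ 1 + 3 * sn 2 v
    saves-third = begin
      n
        ≡⟨ ∣⊤∣≡n n ⟨
      ∣ ⊤ {n} ∣
        ≤⟨ p⊆q⇒∣p∣≤∣q∣ {p = ⊤} (λ {w} _ → somewhere w) ⟩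
      ∣ ⁅ v ⁆ ∪ (S₁ ∪ (S₂ ∪ S₃)) ∣
        ≤⟨ ∣p∪q∣≤∣p∣+∣q∣ ⁅ v ⁆ _ ⟩
      ∣ ⁅ v ⁆ ∣ + ∣ S₁ ∪ (S₂ ∪ S₃) ∣
        ≤⟨ ℕ.+-mono-≤ (ℕ.≤-reflexive (∣⁅x⁆∣≡1 v)) (∣p∪q∣≤∣p∣+∣q∣ S₁ _) ⟩
      1 + (∣ S₁ ∣ + ∣ S₂ ∪ S₃ ∣)
        ≤⟨ s≤s (ℕ.+-mono-≤ (best-upper 2 n _ _ A.legal) (∣p∪q∣≤∣p∣+∣q∣ S₂ S₃)) ⟩
      1 + (sn 2 v + (∣ S₂ ∣ + ∣ S₃ ∣))
        ≤⟨ s≤s (ℕ.+-monoʳ-≤ (sn 2 v) (ℕ.+-mono-≤ (best-upper 2 n _ _ B.legal)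
             (ℕ.≤-trans (best-upper 2 n _ _ C.legal) (ℕ.m≤m+n _ 0)))) ⟩
      1 + 3 * sn 2 v ∎
      where
      open ℕ.≤-Reasoning
      open Trisection trisection
      module A = Side region₁ minority₁
      module B = Side region₂ minority₂
      module C = Side region₃ minority₃
      S₁ S₂ S₃ : Subset n
      S₁ = ∁ (burning (run A.strategy (ignite v) n))
      S₂ = ∁ (burning (run B.strategy (ignite v) n))
      S₃ = ∁ (burning (run C.strategy (ignite v) n))
      in₁ : ∀ {w} → w ∉ burning (run A.strategy (ignite v) n) → w ∈ ⁅ v ⁆ ∪ (S₁ ∪ (S₂ ∪ S₃))
      in₁ p = x∈p∪q⁺ (inj₂ (x∈p∪q⁺ (inj₁ (x∉p⇒x∈∁p p))))
      in₂ : ∀ {w} → w ∉ burning (run B.strategy (ignite v) n) → w ∈ ⁅ v ⁆ ∪ (S₁ ∪ (S₂ ∪ S₃))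
      in₂ p = x∈p∪q⁺ (inj₂ (x∈p∪q⁺ {p = S₁} (inj₂ (x∈p∪q⁺ (inj₁ (x∉p⇒x∈∁p p))))))
      in₃ : ∀ {w} → w ∉ burning (run C.strategy (ignite v) n) → w ∈ ⁅ v ⁆ ∪ (S₁ ∪ (S₂ ∪ S₃))
      in₃ p = x∈p∪q⁺ (inj₂ (x∈p∪q⁺ {p = S₁} (inj₂ (x∈p∪q⁺ {p = S₂} (inj₂ (x∉p⇒x∈∁p p))))))
      somewhere : ∀ w → w ∈ ⁅ v ⁆ ∪ (S₁ ∪ (S₂ ∪ S₃))
      somewhere w with w ≟ v | A.wall? w | B.wall? w | C.wall? w | any? (w ~?_)
      ... | yes refl | _ | _ | _ | _ = x∈p∪q⁺ (inj₁ (x∈⁅x⁆ w))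
      ... | no w≢v | yes p | _ | _ | _ = in₁ (A.saved w≢v (inj₁ p))
      ... | no w≢v | no _ | yes p | _ | _ = in₂ (B.saved w≢v (inj₁ p))
      ... | no w≢v | no _ | no _ | yes p | _ = in₃ (C.saved w≢v (inj₁ p))
      ... | no w≢v | no _ | no _ | no _ | no isolated =
        in₁ (A.saved w≢v (inj₂ (λ w~u → contradiction (_ , w~u) isolated)))
      -- Off all walls each labelling is constant around `w`, so the side that covers one dart
      -- contains all darts at `w`.
      ... | no w≢v | no ¬p₁ | no ¬p₂ | no ¬p₃ | yes (u , w~u) with cover (w , u)
      ...   | inj₁ eq =
        in₁ (A.saved w≢v (inj₂ (λ w~u′ → trans (proj₁ (A.uniform ¬p₁) w~u′ w~u) eq)))
      ...   | inj₂ (inj₁ eq) =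
        in₂ (B.saved w≢v (inj₂ (λ w~u′ → trans (proj₁ (B.uniform ¬p₂) w~u′ w~u) eq)))
      ...   | inj₂ (inj₂ eq) =
        in₃ (C.saved w≢v (inj₂ (λ w~u′ → trans (proj₁ (C.uniform ¬p₃) w~u′ w~u) eq)))

-- The edge bound for girth 5

module Degrees {n : ℕ} (G : SimpleGraph n) where
  open SimpleGraph G
  open Edges G

  degree : Fin n → ℕ
  degree v = length (filter (v ~?_) (allFin n))

  dartCode : ∀ {u w} → u ~ w → Fin (length edges) ⊎ Fin (length edges)
  dartCode {u} {w} p with u <? w
  ... | yes _ = inj₁ (index (orient-∈ p))
  ... | no  _ = inj₂ (index (orient-∈ p))

  dartCode-injective : ∀ {u w u′ w′} (p : u ~ w) (q : u′ ~ w′) → dartCode p ≡ dartCode q →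
                       (u , w) ≡ (u′ , w′)
  dartCode-injective {u} {w} {u′} {w′} p q eq with u <? w | u′ <? w′
  ... | yes u<w | yes u′<w′
    with orient-≡ {u , w} {u′ , w′} (index-injective (orient-∈ p) (orient-∈ q) (inj₁-injective eq))
  ...   | inj₁ d≡e  = d≡e
  ...   | inj₂ refl = contradiction u′<w′ (Fin.<-asym u<w)
  dartCode-injective {u} {w} {u′} {w′} p q eq | no u≮w | no u′≮w′
    with orient-≡ {u , w} {u′ , w′} (index-injective (orient-∈ p) (orient-∈ q) (inj₂-injective eq))
  ...   | inj₁ d≡e  = d≡e
  ...   | inj₂ refl with Fin.<-cmp u w
  ...     | tri< u<w _ _ = contradiction u<w u≮w
  ...     | tri≈ _ u≡w _ = contradiction p (~-irrefl u≡w)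
  ...     | tri> _ _ w<u = contradiction w<u u′≮w′

  degree-sum : sum (map degree (allFin n)) ≤ⁿ length edges + length edges
  degree-sum = ℕ.≤-trans
    (ℕ.≤-reflexive (sym (length-filter-cartesianProduct adjacent? (allFin n) (allFin n))))
    (injective⇒≤ {f = λ i → join _ _ (dartCode (adjacent i))} λ {i} {j} eq →
      lookup-injective (filter⁺ adjacent? (cartesianProduct⁺ (allFin⁺ n) (allFin⁺ n)))
        (dartCode-injective (adjacent i) (adjacent j) (join-injective eq)))
    where
    adjacent? : (d : Fin n × Fin n) → Dec (proj₁ d ~ proj₂ d)
    adjacent? (u , w) = u ~? w
    darts : List (Fin n × Fin n)
    darts = filter adjacent? (cartesianProduct (allFin n) (allFin n))
    adjacent : ∀ i → proj₁ (lookup darts i) ~ proj₂ (lookup darts i)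
    adjacent i = proj₂ (∈-filter⁻ adjacent? {xs = cartesianProduct (allFin n) (allFin n)}
                                  (∈-lookup {xs = darts} i))

module EdgeBound {n : ℕ} (G : SimpleGraph n) (pl : Planar G) (girth : GirthAtLeast G 5) where
  open SimpleGraph G
  open Planar pl
  open RotationSystem rotationSystem
  open Edges G
  open Degrees G
  open Darts G rotationSystem
  open FaceLabels G pl
  private
    module Faces = HasClasses faces
    module Components = HasClasses components

  no-triangle : ∀ {u w x} → u ~ w → w ~ x → x ~ u → ⊥
  no-triangle {u} {w} {x} u~w w~x x~u = ℕ.<⇒≱ (s≤s (s≤s (s≤s (s≤s z≤n))))
    (girth (cycle (lookup (u ∷ w ∷ x ∷ [])) (s≤s (s≤s (s≤s z≤n)))
      (lookup-injective ((~⇒≢ u~w ∷ ~⇒≢ (~-sym x~u) ∷ []) ∷ (~⇒≢ w~x ∷ []) ∷ [] ∷ []))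
      (λ { zero → u~w ; (suc zero) → w~x }) x~u))

  no-square : ∀ {u w x y} → u ~ w → w ~ x → x ~ y → y ~ u → u ≢ x → w ≢ y → ⊥
  no-square {u} {w} {x} {y} u~w w~x x~y y~u u≢x w≢y = ℕ.<⇒≱ (s≤s (s≤s (s≤s (s≤s (s≤s z≤n)))))
    (girth (cycle (lookup (u ∷ w ∷ x ∷ y ∷ [])) (s≤s (s≤s (s≤s z≤n)))
      (lookup-injective ((~⇒≢ u~w ∷ u≢x ∷ ~⇒≢ (~-sym y~u) ∷ []) ∷ (~⇒≢ w~x ∷ w≢y ∷ []) ∷
                         (~⇒≢ x~y ∷ []) ∷ [] ∷ []))
      (λ { zero → u~w ; (suc zero) → w~x ; (suc (suc zero)) → x~y }) y~u))

  -- A facial walk of length at most 4 is the boundary of a tree component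
  -- with at most two edges.
  Short : Fin n × Fin n → Set
  Short d = ∃[ k ] iterate nextDart d (suc (toℕ {4} k)) ≡ d

  short? : ∀ d → Dec (Short d)
  short? d = any? (λ k → iterate nextDart d (suc (toℕ k)) ≟ᵈ d)

  short-iterate : ∀ {d} j → Short d → Short (iterate nextDart d j)
  short-iterate zero    s        = s
  short-iterate {d} (suc j) (k , eq) = short-iterate j
    (k , trans (iterate-suc nextDart d (suc (toℕ k))) (cong nextDart eq))

  -- Girth 5 leaves neither triangle nor square, so a closed facial walk of at most 4 steps has to
  -- turn back; the place of the turn locates the reversed dart.
  short-swap : ∀ {d} → IsDart d → Short d → ∃[ j ] iterate nextDart d j ≡ swap d
  short-swap p (zero , eq) = contradiction eq (nextDart≢ p)
  short-swap {u , w} p (suc zero , eq) = 1 , cong (w ,_) (cong proj₁ eq)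
  short-swap {u , w} p (suc (suc zero) , eq) =
    contradiction (subst (rot w u ~_) (cong proj₁ eq) (iterate-dart 2 p))
                  (no-triangle p (iterate-dart 1 p))
  short-swap {u , w} p (suc (suc (suc zero)) , eq) with u ≟ rot w u | w ≟ rot (rot w u) w
  ... | yes u≡x | _       = 1 , cong (w ,_) (sym u≡x)
  ... | no  _   | yes w≡y = 3 , cong₂ _,_ (sym w≡y) (cong proj₁ eq)
  ... | no  u≢x | no w≢y  = contradiction w≢y (no-square p (iterate-dart 1 p) (iterate-dart 2 p)
    (subst (rot (rot w u) w ~_) (cong proj₁ eq) (iterate-dart 3 p)) u≢x)

  private
    dart : Fin #faces → Dart
    dart f = proj₁ (Faces.class-surjective f)

    class-dart : ∀ f → Faces.class (dart f) ≡ f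
    class-dart f = proj₂ (Faces.class-surjective f)

    Short-face : Fin #faces → Set
    Short-face f = Short (proj₁ (dart f))

    step : ∀ f (j : ℕ) → IsDart (iterate nextDart (proj₁ (dart f)) j)
    step f j = iterate-dart j (proj₂ (dart f))

    component : Fin #faces → Fin #components
    component f = Components.class (proj₁ (proj₁ (dart f)))

  short-face-swap : ∀ {f d} → Short-face f → IsDart d → face f d ≡ f → face f (swap d) ≡ f
  short-face-swap {f} {d} s p eq
    with Equivalence.to (Faces.class-kernel (dart f) (d , p))
           (trans (class-dart f) (trans (sym eq) (face-class p)))
  ... | j , refl with short-swap p (short-iterate j s)
  ...   | i , swapped = trans (face-class (~-sym p)) (trans
    (sym (Equivalence.from (Faces.class-kernel (d , p) (swap d , ~-sym p)) (i , swapped)))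
    (trans (sym (face-class p)) eq))

  -- A short face contains each of its darts reversed, so membership in it is preserved by facial
  -- steps and by reversal. It is therefore the only face of its component, and can claim that
  -- component's marks.
  short-component : ∀ {f f′} → Short-face f → component f ≡ component f′ → f ≡ f′
  short-component {f} {f′} s eq = witness (face f (proj₁ (dart f′)) ≟ f) same
    where
    σ : Fin n × Fin n → Bool
    σ d = does (face f d ≟ f)
    face-dart : ∀ g → face f (proj₁ (dart g)) ≡ g
    face-dart g = trans (face-class (proj₂ (dart g))) (class-dart g)
    flip : ∀ {d} → IsDart d → σ d ≡ σ (swap d)
    flip {d} p with face f d ≟ f | face f (swap d) ≟ f
    ... | yes _ | yes _ = refl
    ... | no _  | no _  = refl
    ... | yes a | no ¬b = contradiction (short-face-swap s p a) ¬b
    ... | no ¬a | yes b = contradiction (short-face-swap s (~-sym p) b) ¬a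
    same : σ (proj₁ (dart f′)) ≡ true
    same = trans (sym (component-constant σ
        (λ p → cong (λ g → does (g ≟ f)) (face-next p)) flip
        (Equivalence.to (Components.class-kernel _ _) eq)
        (proj₂ (dart f)) (proj₂ (dart f′))))
      (dec-true (face f (proj₁ (dart f)) ≟ f) (face-dart f))
    witness : (a : Dec (face f (proj₁ (dart f′)) ≡ f)) → does a ≡ true → f ≡ f′
    witness (yes a) _ = trans (sym a) (face-dart f′)

  -- A long face owns its first five darts; a short one has only two darts
  -- but owns three marks of its component.
  faces≤ : #faces * 5 ≤ⁿ (length edges + length edges) + 3 * #components
  faces≤ = injective⇒≤ {f = λ i → join _ _ (code (slotAt (remQuot {#faces} 5 i)))} λ {i} {j} eq →
    trans (sym (combine-remQuot {#faces} 5 i)) (trans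
      (cong (uncurry combine) (slot-injective _ _ (short? _) (short? _) _ _
        (code-injective _ _ (join-injective eq))))
      (combine-remQuot {#faces} 5 j))
    where
    Slot : Set
    Slot = Dart ⊎ (Fin 3 × Fin #components)
    slot : ∀ f → Dec (Short-face f) → Fin 5 → Slot
    slot f (no _)  i             = inj₁ (_ , step f (toℕ i))
    slot f (yes _) zero          = inj₁ (_ , step f 0)
    slot f (yes _) (suc zero)    = inj₁ (_ , step f 1)
    slot f (yes _) (suc (suc i)) = inj₂ (i , component f)
    code : Slot → Fin (length edges + length edges) ⊎ Fin (3 * #components)
    code (inj₁ (_ , p)) = inj₁ (join _ _ (dartCode p))
    code (inj₂ (i , c)) = inj₂ (combine i c)
    slotAt : Fin #faces × Fin 5 → Slot
    slotAt (f , i) = slot f (short? _) i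
    _≈_ : Slot → Slot → Set
    inj₁ (d , _) ≈ inj₁ (e , _) = d ≡ e
    inj₂ x       ≈ inj₂ y       = x ≡ y
    _            ≈ _            = ⊥
    code-injective : ∀ x y → code x ≡ code y → x ≈ y
    code-injective (inj₁ (_ , p)) (inj₁ (_ , q)) eq =
      dartCode-injective p q (join-injective (inj₁-injective eq))
    code-injective (inj₂ (i , c)) (inj₂ (j , c′)) eq =
      uncurry (cong₂ _,_) (combine-injective i c j c′ (inj₂-injective eq))
    same-face : ∀ f f′ i j → iterate nextDart (proj₁ (dart f)) i ≡ iterate nextDart (proj₁ (dart f′)) j →
                f ≡ f′
    same-face f f′ i j eq = trans (sym (class-dart f)) (trans
      (Equivalence.from (Faces.class-kernel (dart f) (_ , step f′ j)) (i , eq))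
      (trans (sym (Equivalence.from (Faces.class-kernel (dart f′) (_ , step f′ j)) (j , refl)))
             (class-dart f′)))
    -- Facial steps are injective, so two equal iterates among the first five cancel to a return
    -- within four steps.
    no-return : ∀ f (i j : Fin 5) → ¬ Short-face f → toℕ i < toℕ j →
      iterate nextDart (proj₁ (dart f)) (toℕ i) ≢ iterate nextDart (proj₁ (dart f)) (toℕ j)
    no-return f i j ¬s i<j eq = ¬s (short-by (toℕ j ∸ toℕ i) (ℕ.m<n⇒0<n∸m i<j)
        (ℕ.≤-trans (ℕ.m∸n≤m (toℕ j) (toℕ i)) (s≤s⁻¹ (toℕ<n j)))
        (sym (iterate-injective (toℕ i) (proj₂ (dart f)) (step f (toℕ j ∸ toℕ i))
          (trans eq (trans (cong (iterate nextDart _) (sym (ℕ.m∸n+n≡m (ℕ.<⇒≤ i<j))))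
                           (iterate-+ nextDart _ (toℕ j ∸ toℕ i) (toℕ i)))))))
      where
      short-by : ∀ {d} k → 0 < k → k ≤ⁿ 4 → iterate nextDart d k ≡ d → Short d
      short-by {d} (suc k) _ k≤4 eq = fromℕ< k≤4 ,
        trans (cong (λ k → iterate nextDart d (suc k)) (Fin.toℕ-fromℕ< k≤4)) eq
    long-injective : ∀ f (i j : Fin 5) → ¬ Short-face f →
      iterate nextDart (proj₁ (dart f)) (toℕ i) ≡ iterate nextDart (proj₁ (dart f)) (toℕ j) → i ≡ j
    long-injective f i j ¬s eq with ℕ.<-cmp (toℕ i) (toℕ j)
    ... | tri< i<j _ _ = contradiction eq (no-return f i j ¬s i<j)
    ... | tri≈ _ i≡j _ = toℕ-injective i≡j
    ... | tri> _ _ j<i = contradiction (sym eq) (no-return f j i ¬s j<i)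
    slot-injective : ∀ f f′ s s′ i j → slot f s i ≈ slot f′ s′ j → (f , i) ≡ (f′ , j)
    slot-injective f f′ (no ¬s) (no _) i j eq with refl ← same-face f f′ (toℕ i) (toℕ j) eq =
      cong (f ,_) (long-injective f i j ¬s eq)
    slot-injective f f′ (no ¬s) (yes s) i zero       eq with refl ← same-face f f′ (toℕ i) 0 eq =
      contradiction s ¬s
    slot-injective f f′ (no ¬s) (yes s) i (suc zero) eq with refl ← same-face f f′ (toℕ i) 1 eq =
      contradiction s ¬s
    slot-injective f f′ (yes s) (no ¬s) zero       j eq with refl ← same-face f f′ 0 (toℕ j) eq =
      contradiction s ¬s
    slot-injective f f′ (yes s) (no ¬s) (suc zero) j eq with refl ← same-face f f′ 1 (toℕ j) eq =
      contradiction s ¬s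
    slot-injective f f′ (yes _) (yes _) zero zero eq = cong (_, zero) (same-face f f′ 0 0 eq)
    slot-injective f f′ (yes _) (yes _) (suc zero) (suc zero) eq = cong (_, suc zero) (same-face f f′ 1 1 eq)
    slot-injective f f′ (yes _) (yes _) zero (suc zero) eq with refl ← same-face f f′ 0 1 eq =
      contradiction (sym eq) (nextDart≢ (proj₂ (dart f)))
    slot-injective f f′ (yes _) (yes _) (suc zero) zero eq with refl ← same-face f f′ 1 0 eq =
      contradiction eq (nextDart≢ (proj₂ (dart f)))
    slot-injective f f′ (yes s) (yes _) (suc (suc i)) (suc (suc j)) eq =
      cong₂ (λ f i → f , suc (suc i)) (short-component s (cong proj₂ eq)) (cong proj₁ eq)

  isolated≤ : length isolatedVertices ≤ⁿ #components
  isolated≤ = count-components {k = 0} components (λ ()) (λ ()) (λ { {()} })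

  -- With `E` edges, `C` components, `F` faces and `I` isolated vertices, five times Euler's formula
  -- together with 5F ≤ 2E + 3C and I ≤ C gives 3E + 2C ≤ 5n; the 2C is given away.
  edges≤ : 3 * length edges ≤ⁿ 5 * n
  edges≤ = ℕ.+-cancelʳ-≤ (2 * E + 8 * C) (3 * E) (5 * n) (begin
    3 * E + (2 * E + 8 * C)           ≤⟨ ℕ.m≤m+n _ (2 * C) ⟩
    3 * E + (2 * E + 8 * C) + 2 * C   ≡⟨ regroup E C ⟩
    5 * (E + 2 * C)                   ≡⟨ cong (5 *_) euler ⟨
    5 * (n + (#faces + I))            ≡⟨ regroup′ n #faces I ⟩
    5 * n + (#faces * 5 + 5 * I)      ≤⟨ ℕ.+-monoʳ-≤ (5 * n)
                                          (ℕ.+-mono-≤ faces≤ (ℕ.*-monoʳ-≤ 5 isolated≤)) ⟩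
    5 * n + (E + E + 3 * C + 5 * C)   ≡⟨ regroup″ n E C ⟩
    5 * n + (2 * E + 8 * C)           ∎)
    where
    open ℕ.≤-Reasoning
    E = length edges
    C = #components
    I = length isolatedVertices
    regroup : ∀ e c → 3 * e + (2 * e + 8 * c) + 2 * c ≡ 5 * (e + 2 * c)
    regroup = solve-∀
    regroup′ : ∀ n f i → 5 * (n + (f + i)) ≡ 5 * n + (f * 5 + 5 * i)
    regroup′ = solve-∀
    regroup″ : ∀ n e c → 5 * n + (e + e + 3 * c + 5 * c) ≡ 5 * n + (2 * e + 8 * c)
    regroup″ = solve-∀

-- The surviving rate

fromList : ∀ {n} → List (Fin n) → Subset n
fromList = foldr (λ x p → ⁅ x ⁆ ∪ p) ∅

∣fromList∣≤length : ∀ {n} (xs : List (Fin n)) → ∣ fromList xs ∣ ≤ⁿ length xs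
∣fromList∣≤length {n} []       = ℕ.≤-reflexive (∣⊥∣≡0 n)
∣fromList∣≤length     (x ∷ xs) = ℕ.≤-trans (∣p∪q∣≤∣p∣+∣q∣ ⁅ x ⁆ (fromList xs))
  (ℕ.+-mono-≤ (ℕ.≤-reflexive (∣⁅x⁆∣≡1 x)) (∣fromList∣≤length xs))

∈-fromList⁺ : ∀ {n} {xs : List (Fin n)} {x} → x ∈ˡ xs → x ∈ fromList xs
∈-fromList⁺ (here refl)              = x∈p∪q⁺ (inj₁ (x∈⁅x⁆ _))
∈-fromList⁺ {xs = y ∷ _} (there x∈) = x∈p∪q⁺ {p = ⁅ y ⁆} (inj₂ (∈-fromList⁺ x∈))

∈-fromList⁻ : ∀ {n} (xs : List (Fin n)) {x} → x ∈ fromList xs → x ∈ˡ xs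
∈-fromList⁻ []       x∈ = contradiction x∈ ∉⊥
∈-fromList⁻ (y ∷ xs) x∈ with x∈p∪q⁻ ⁅ y ⁆ (fromList xs) x∈
... | inj₁ x∈y = here (x∈⁅y⁆⇒x≡y y x∈y)
... | inj₂ x∈s = there (∈-fromList⁻ xs x∈s)

module _ {n : ℕ} (G : SimpleGraph n) where
  open SimpleGraph G
  open Firefighter G
  open FirefighterProperties G
  open Degrees G

  -- Protecting all neighbours in round 0 confines the fire to `v`. Repeating the same move stays
  -- legal because those neighbours never burn.
  degree≤⇒saves-rest : ∀ k v → degree v ≤ⁿ k → n ≤ⁿ 1 + sn k v
  degree≤⇒saves-rest k v d≤k = begin
    n                                            ≡⟨ ∣⊤∣≡n n ⟨
    ∣ ⊤ {n} ∣                                    ≤⟨ p⊆q⇒∣p∣≤∣q∣ {p = ⊤} (λ {w} _ → covered w) ⟩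
    ∣ ⁅ v ⁆ ∪ ∁ (burning (run s (ignite v) n)) ∣ ≤⟨ ∣p∪q∣≤∣p∣+∣q∣ ⁅ v ⁆ _ ⟩
    _                                            ≤⟨ ℕ.+-mono-≤ (ℕ.≤-reflexive (∣⁅x⁆∣≡1 v))
                                                      (best-upper k n _ s legal) ⟩
    1 + sn k v                                   ∎
    where
    open ℕ.≤-Reasoning
    neighbours : List (Fin n)
    neighbours = filter (v ~?_) (allFin n)
    s : Strategy
    s _ = fromList neighbours
    contained : ∀ t {w} → w ∈ burning (run s (ignite v) t) → w ≡ v
    contained zero    w∈ = x∈⁅y⁆⇒x≡y v w∈
    contained (suc t) w∈ with ∈-spread⁻ _ (burning (run s (ignite v) t)) w∈
    ... | inj₁ w∈B = contained t w∈B
    ... | inj₂ (w∉ , u , u∈ , u~w) with refl ← contained t u∈ =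
      contradiction (x∈p∪q⁺ {p = protected (run s (ignite v) t)}
        (inj₂ (∈-fromList⁺ (∈-filter⁺ (v ~?_) (∈-allFin _) u~w)))) w∉
    legal : Legal k (ignite v) s
    legal t = ℕ.≤-trans (∣fromList∣≤length neighbours) d≤k , λ w∈ w∈B →
      ~-irrefl (sym (contained t w∈B))
        (proj₂ (∈-filter⁻ (v ~?_) {xs = allFin n} (∈-fromList⁻ neighbours w∈)))
    covered : ∀ w → w ∈ ⁅ v ⁆ ∪ ∁ (burning (run s (ignite v) n))
    covered w with w ≟ v
    ... | yes refl = x∈p∪q⁺ (inj₁ (x∈⁅x⁆ w))
    ... | no w≢v   = x∈p∪q⁺ {p = ⁅ v ⁆} (inj₂ (x∉p⇒x∈∁p (λ w∈ → w≢v (contained n w∈))))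

  degree-3⇒saves-third : Planar G → ∀ v → degree v ≡ 3 → n ≤ⁿ 1 + 3 * sn 2 v
  degree-3⇒saves-third pl v d≡3 =
    go (filter (v ~?_) (allFin n)) d≡3 (filter⁺ (v ~?_) (allFin⁺ n))
       (λ u∈ → proj₂ (∈-filter⁻ (v ~?_) {xs = allFin n} u∈))
       (λ v~u → ∈-filter⁺ (v ~?_) (∈-allFin _) v~u)
    where
    open Planar pl
    forest = breadthFirst G rotationSystem components v
    go : ∀ xs → length xs ≡ 3 → Unique xs →
         (∀ {u} → u ∈ˡ xs → v ~ u) → (∀ {u} → v ~ u → u ∈ˡ xs) → n ≤ⁿ 1 + 3 * sn 2 v
    go (u₁ ∷ u₂ ∷ u₃ ∷ []) refl ((u₁≢u₂ ∷ u₁≢u₃ ∷ []) ∷ (u₂≢u₃ ∷ []) ∷ [] ∷ []) adj all =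
      Fight.ThreeNeighbours.saves-third G pl (proj₁ forest) v (proj₂ forest)
        (adj (here refl)) (adj (there (here refl))) (adj (there (there (here refl))))
        u₁≢u₂ u₁≢u₃ u₂≢u₃ (λ v~u → cases (all v~u))
      where
      cases : ∀ {u} → u ∈ˡ u₁ ∷ u₂ ∷ u₃ ∷ [] → u ≡ u₁ ⊎ u ≡ u₂ ⊎ u ≡ u₃
      cases (here eq)                 = inj₁ eq
      cases (there (here eq))         = inj₂ (inj₁ eq)
      cases (there (there (here eq))) = inj₂ (inj₂ eq)

-- Vertices of degree at least 4 contribute nothing; the others save enough to be
-- charged against the missing degree 4 − degree v.
saved-or-degree : ∀ {m} (G : SimpleGraph (suc m)) → Planar G → ∀ v →
  m * 4 ≤ⁿ 4 * Firefighter.sn G 2 v + m * Degrees.degree G v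
saved-or-degree {m} G pl v = by (degree v) refl
  where
  open Degrees G
  open Firefighter G
  open ℕ.≤-Reasoning
  quarter : m ≤ⁿ sn 2 v → ∀ d → m * 4 ≤ⁿ 4 * sn 2 v + m * d
  quarter m≤ d = begin
    m * 4               ≡⟨ ℕ.*-comm m 4 ⟩
    4 * m               ≤⟨ ℕ.*-monoʳ-≤ 4 m≤ ⟩
    4 * sn 2 v          ≤⟨ ℕ.m≤m+n _ (m * d) ⟩
    4 * sn 2 v + m * d  ∎
  few : degree v ≤ⁿ 2 → m * 4 ≤ⁿ 4 * sn 2 v + m * degree v
  few d≤2 = quarter (s≤s⁻¹ (degree≤⇒saves-rest G 2 v d≤2)) (degree v)
  by : ∀ d → degree v ≡ d → m * 4 ≤ⁿ 4 * sn 2 v + m * degree v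
  by 0 eq = few (subst (_≤ⁿ 2) (sym eq) z≤n)
  by 1 eq = few (subst (_≤ⁿ 2) (sym eq) (s≤s z≤n))
  by 2 eq = few (ℕ.≤-reflexive eq)
  by 3 eq = begin
    m * 4                   ≡⟨ ℕ.*-suc m 3 ⟩
    m + m * 3               ≤⟨ ℕ.+-monoˡ-≤ (m * 3) (ℕ.≤-trans (s≤s⁻¹ (degree-3⇒saves-third G pl v eq))
                                                     (ℕ.m≤n+m _ (sn 2 v))) ⟩
    4 * sn 2 v + m * 3      ≡⟨ cong (λ d → 4 * sn 2 v + m * d) eq ⟨
    4 * sn 2 v + m * degree v ∎
  by (suc (suc (suc (suc d)))) eq = begin
    m * 4               ≤⟨ ℕ.*-monoʳ-≤ m (s≤s (s≤s (s≤s (s≤s z≤n)))) ⟩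
    m * (4 + d)         ≡⟨ cong (m *_) eq ⟨
    m * degree v        ≤⟨ ℕ.m≤n+m _ (4 * sn 2 v) ⟩
    4 * sn 2 v + m * degree v ∎

sum-map-linear : ∀ {A : Set} (f g : A → ℕ) a b (xs : List A) →
  sum (map (λ x → a * f x + b * g x) xs) ≡ a * sum (map f xs) + b * sum (map g xs)
sum-map-linear f g a b [] = cong₂ _+_ (sym (ℕ.*-zeroʳ a)) (sym (ℕ.*-zeroʳ b))
sum-map-linear f g a b (x ∷ xs) =
  trans (cong (λ s → a * f x + b * g x + s) (sum-map-linear f g a b xs))
        (regroup a b (f x) (g x) (sum (map f xs)) (sum (map g xs)))
  where
  regroup : ∀ a b p q s t → a * p + b * q + (a * s + b * t) ≡ a * (p + s) + b * (q + t)
  regroup = solve-∀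

sum-map-const : ∀ {A : Set} c (xs : List A) → sum (map (λ _ → c) xs) ≡ length xs * c
sum-map-const c []       = refl
sum-map-const c (x ∷ xs) = cong (λ s → c + s) (sum-map-const c xs)

-- Degrees sum to at most 10n/3, so the signed deficits 4 - degree sum to at least 2n/3. Each unit
-- of deficit is worth (n - 1)/4 saved vertices, in total at least n(n - 1)/6, and n - 1 ≥ n/2 gives
-- the constant 12.
n²≤12Σsn : ∀ {n} (G : SimpleGraph n) → 2 ≤ⁿ n → Planar G → GirthAtLeast G 5 →
           n * n ≤ⁿ 12 * sum (map (Firefighter.sn G 2) (allFin n))
n²≤12Σsn {suc m} G (s≤s 1≤m) pl girth = ℕ.≤-trans
  (ℕ.*-monoʳ-≤ n (ℕ.+-monoˡ-≤ m 1≤m))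
  (ℕ.+-cancelʳ-≤ (10 * (m * n)) _ _ (begin
    n * (m + m) + 10 * (m * n)   ≡⟨ regroup n m ⟩
    3 * (n * (m * 4))            ≤⟨ ℕ.*-monoʳ-≤ 3 total ⟩
    3 * (4 * S + m * D)          ≤⟨ ℕ.*-monoʳ-≤ 3 (ℕ.+-monoʳ-≤ (4 * S)
                                      (ℕ.*-monoʳ-≤ m (Degrees.degree-sum G))) ⟩
    3 * (4 * S + m * (E + E))    ≡⟨ regroup′ S m E ⟩
    12 * S + 2 * (m * (3 * E))   ≤⟨ ℕ.+-monoʳ-≤ (12 * S) (ℕ.*-monoʳ-≤ 2
                                      (ℕ.*-monoʳ-≤ m (EdgeBound.edges≤ G pl girth))) ⟩
    12 * S + 2 * (m * (5 * n))   ≡⟨ regroup″ S m n ⟩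
    12 * S + 10 * (m * n)        ∎))
  where
  open ℕ.≤-Reasoning
  n = suc m
  S = sum (map (Firefighter.sn G 2) (allFin n))
  D = sum (map (Degrees.degree G) (allFin n))
  E = length (SimpleGraph.edges G)
  total : n * (m * 4) ≤ⁿ 4 * S + m * D
  total = begin
    n * (m * 4)                            ≡⟨ cong (_* (m * 4)) (length-tabulate {n = n} (λ i → i)) ⟨
    length (allFin n) * (m * 4)            ≡⟨ sum-map-const (m * 4) (allFin n) ⟨
    sum (map (λ _ → m * 4) (allFin n))     ≤⟨ sum-map-≤ _ _ (allFin n) (saved-or-degree G pl) ⟩
    sum (map (λ v → 4 * Firefighter.sn G 2 v + m * Degrees.degree G v) (allFin n))
                                           ≡⟨ sum-map-linear (Firefighter.sn G 2) (Degrees.degree G) 4 m (allFin n) ⟩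
    4 * S + m * D                          ∎
  regroup : ∀ n m → n * (m + m) + 10 * (m * n) ≡ 3 * (n * (m * 4))
  regroup = solve-∀
  regroup′ : ∀ s m e → 3 * (4 * s + m * (e + e)) ≡ 12 * s + 2 * (m * (3 * e))
  regroup′ = solve-∀
  regroup″ : ∀ s m n → 12 * s + 2 * (m * (5 * n)) ≡ 12 * s + 10 * (m * n)
  regroup″ = solve-∀

/-mono-≤ : ∀ a b c d .{{_ : NonZero b}} .{{_ : NonZero d}} →
           a * d ≤ⁿ c * b → + a / b ≤ + c / d
/-mono-≤ a (suc b) c (suc d) ad≤cb = ℚ.toℚᵘ-cancel-≤
  (ℚᵘ.≤-respˡ-≃ (ℚᵘ.≃-sym (ℚ.toℚᵘ-fromℚᵘ (ℚᵘ.mkℚᵘ (+ a) b)))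
    (ℚᵘ.≤-respʳ-≃ (ℚᵘ.≃-sym (ℚ.toℚᵘ-fromℚᵘ (ℚᵘ.mkℚᵘ (+ c) d)))
      (ℚᵘ.*≤* (subst₂ ℤ._≤_ (ℤ.pos-* a (suc d)) (ℤ.pos-* c (suc b)) (+≤+ ad≤cb)))))

theorem2 : ∀ {n : ℕ} .{{_ : NonZero n}} (G : SimpleGraph n) →
    2 ≤ⁿ n → Planar G → GirthAtLeast G 5 →
    + 1 / 22 ≤ Firefighter.ρ G 2
theorem2 {n} G 2≤n pl girth = /-mono-≤ 1 22 S (n * n) {{_}} {{ℕ.m*n≢0 n n}} (begin
  1 * (n * n)  ≡⟨ ℕ.*-identityˡ (n * n) ⟩
  n * n        ≤⟨ n²≤12Σsn G 2≤n pl girth ⟩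
  -- The argument yields the stronger bound 1/12, relaxed here.
  12 * S       ≤⟨ ℕ.*-monoˡ-≤ S (ℕ.m≤m+n 12 10) ⟩
  22 * S       ≡⟨ ℕ.*-comm 22 S ⟩
  S * 22       ∎)
  where
  open ℕ.≤-Reasoning
  S = sum (map (Firefighter.sn G 2) (allFin n))
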